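{- There exist a constant $c_0\in(0,1)$ and a 1-sided error, nonadaptive, $t$-online-erasure-resilient $\varepsilon$-tester for linearity of functions $f:\{0,1\}^d\to\{0,1\}$ that is correct whenever $t\le c_0\cdot\varepsilon^{5/4}\cdot 2^{d/4}$ and makes $O\big(\frac1\varepsilon\log\frac t\varepsilon\big)$ queries.
   Context: Online-erasure model. An input is a function $f:D\to R$ on a finite domain $D$. An algorithm accesses $f$ only through an oracle $\mathcal{O}$ by querying points $x\in D$ one at a time and receiving $\mathcal{O}(x)$. Initially $\mathcal{O}(x)=f(x)$ for all $x\in D$. For $t\in\mathbb{N}$, a $t$-online-erasure oracle, after answering each query, may choose up to $t$ points $x\in D$ and set $\mathcal{O}(x)=\perp$ (a special "erased" symbol); these values are used to answer all future queries. The choice of erasures (the adversarial strategy) may depend on $f$, on the queries and answers so far, and on the algorithm's code, but not on the algorithm's future random coins; the algorithm does not know where erasures are. A property $\mathcal{P}$ is a set of functions; $f$ is $\varepsilon$-far from $\mathcal{P}$ if for every $g\in\mathcal{P}$, $f$ and $g$ differ on at least an $\varepsilon$ fraction of $D$. A $t$-online-erasure-resilient $\varepsilon$-tester for $\mathcal{P}$ is a randomized algorithm that, given $t,\varepsilon$ and access to $f$ via a $t$-online-erasure oracle, for every adversarial strategy accepts with probability at least $2/3$ if $f\in\mathcal{P}$ and rejects with probability at least $2/3$ if $f$ is $\varepsilon$-far from $\mathcal{P}$. It has 1-sided error if it accepts every $f\in\mathcal{P}$ with probability 1; it is nonadaptive if its queries do not depend on answers to previous queries. A function $f:\{0,1\}^d\to\{0,1\}$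 is linear if there is $S\subseteq[d]$ with $f(x)=\sum_{i\in S}x[i]\bmod 2$ for all $x$.
   Formalization: The proximity parameter ε ranges over rational numbers in (0,1] rather than real numbers (the constant c₀ is rational too, which loses nothing); at t = 0, where log(t/ε) is undefined, the query bound is read as O((1/ε) log(2/ε)). -}

module Defs where

open import Data.Bool.Base using (Bool; true; false; not; _∧_; _xor_; if_then_else_)
import Data.Bool.Properties as Bool
open import Data.Fin.Base using (Fin)
open import Data.Fin.Subset using (Subset)
open import Data.Integer.Base using (+_; ∣_∣)
open import Data.List.Base using (List; []; _∷_; _++_; map; filter; filterᵇ; length; allFin)
import Data.List.Membership.DecPropositional as DecMembership
open import Data.Maybe.Base using (Maybe; just; nothing)
open import Data.Nat.Base as ℕ using (ℕ; zero; suc)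
open import Data.Nat.Properties using (m^n≢0)
open import Data.Product.Base using (_×_; ∃-syntax; _,_)
open import Data.Rational.Base using (ℚ; 1ℚ; _/_; _÷_; _≤_; _*_; ↥_; ↧ₙ_; NonZero; +-*-rawSemiring)
open import Data.Vec.Base as Vec using (Vec; []; _∷_)
open import Data.Vec.Bounded.Base as Vec≤ using (Vec≤)
import Data.Vec.Properties as Vec
open import Relation.Binary.Definitions using (DecidableEquality)
open import Relation.Binary.PropositionalEquality using (_≡_)
open import Relation.Nullary.Decidable using (does; ¬?)

open import Algebra.Definitions.RawSemiring +-*-rawSemiring public using (_^_)

fromℕ : ℕ → ℚ
fromℕ n = + n / 1

------------------------------------------------------------------------
-- Boolean functions on the hypercube

Cube : ℕ → Set
Cube d = Vec Bool d

_≟_ : ∀ {d} → DecidableEquality (Cube d)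
_≟_ = Vec.≡-dec Bool._≟_

points : ∀ d → List (Cube d)
points zero    = [] ∷ []
points (suc d) = map (false ∷_) (points d) ++ map (true ∷_) (points d)

BoolFun : ℕ → Set
BoolFun d = Cube d → Bool

Property : ℕ → Set₁
Property d = BoolFun d → Set

-- A subset S is its characteristic vector, so this is the sum mod 2 of
-- the coordinates x[i] with i ∈ S.
parity : ∀ {d} → Subset d → BoolFun d
parity S x = Vec.foldr′ _xor_ false (Vec.zipWith _∧_ S x)

Linear : ∀ d → Property d
Linear d f = ∃[ S ] (∀ x → f x ≡ parity S x)

distance : ∀ {d} → BoolFun d → BoolFun d → ℚ
distance {d} f g =
  (+ length (filter (λ x → ¬? (f x Bool.≟ g x)) (points d)) / (2 ℕ.^ d)) {{m^n≢0 2 d}}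

Far : ∀ {d} → ℚ → Property d → BoolFun d → Set
Far ε P f = ∀ g → P g → ε ≤ distance f g

------------------------------------------------------------------------
-- Query algorithms

-- `nothing` is the erasure symbol ⊥.
Answer : Set
Answer = Maybe Bool

-- `output true` accepts, `output false` rejects.
data Algorithm (d : ℕ) : Set where
  output : Bool → Algorithm d
  query  : Cube d → (Answer → Algorithm d) → Algorithm d

data QueryBound {d : ℕ} : ℕ → Algorithm d → Set where
  output : ∀ {q b} → QueryBound q (output b)
  query  : ∀ {q x k} → (∀ a → QueryBound q (k a)) → QueryBound (suc q) (query x k)

-- Whatever answers it receives, the algorithm queries exactly the listed
-- points, in the listed order.
data Asks {d : ℕ} : Algorithm d → List (Cube d) → Set where
  output : ∀ {b} → Asks (output b) []
  query  : ∀ {x k xs} → (∀ a → Asks (k a) xs) → Asks (query x k) (x ∷ xs)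

-- All coins are drawn as one uniform outcome of a nonempty finite set; the
-- outcome is visible to others only through the queries it leads to.
record RandomizedAlgorithm (d : ℕ) : Set where
  field
    coins-1 : ℕ
    branch  : Fin (suc coins-1) → Algorithm d

open RandomizedAlgorithm public

Pr : ∀ {n} → (Fin (suc n) → Bool) → ℚ
Pr {n} event = + length (filterᵇ event (allFin (suc n))) / suc n

MakesAtMost : ∀ {d} → ℕ → RandomizedAlgorithm d → Set
MakesAtMost q T = ∀ ω → QueryBound q (branch T ω)

Nonadaptive : ∀ {d} → RandomizedAlgorithm d → Set
Nonadaptive T = ∀ ω → ∃[ xs ] Asks (branch T ω) xs

------------------------------------------------------------------------
-- Online erasures

Oracle : ℕ → Set
Oracle d = Cube d → Answer

-- Queries with their answers, most recent first.
History : ℕ → Set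
History d = List (Cube d × Answer)

-- The points to erase after the last query of the history was answered.
Strategy : ℕ → ℕ → Set
Strategy t d = History d → Vec≤ (Cube d) t

erase : ∀ {d} → List (Cube d) → Oracle d → Oracle d
erase xs O x = if does (x ∈? xs) then nothing else O x
  where open DecMembership _≟_ using (_∈?_)

execute : ∀ {t d} → Strategy t d → History d → Oracle d → Algorithm d → Bool
execute σ h O (output b)  = b
execute σ h O (query x k) = execute σ h′ (erase (Vec≤.toList (σ h′)) O) (k (O x))
  where h′ = (x , O x) ∷ h

accepts : ∀ {t d} → BoolFun d → Strategy t d → Algorithm d → Bool
accepts f σ = execute σ [] (λ x → just (f x))

Pr[accept] : ∀ {t d} → RandomizedAlgorithm d → BoolFun d → Strategy t d → ℚ
Pr[accept] T f σ = Pr (λ ω → accepts f σ (branch T ω))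

Pr[reject] : ∀ {t d} → RandomizedAlgorithm d → BoolFun d → Strategy t d → ℚ
Pr[reject] T f σ = Pr (λ ω → not (accepts f σ (branch T ω)))

-- σ is quantified after T and f, hence may depend on both.
IsResilientTester : ∀ {d} → ℕ → ℚ → Property d → RandomizedAlgorithm d → Set
IsResilientTester {d} t ε P T =
  ∀ (f : BoolFun d) (σ : Strategy t d) →
    (P f → + 2 / 3 ≤ Pr[accept] T f σ) ×
    (Far ε P f → + 2 / 3 ≤ Pr[reject] T f σ)

OneSided : ∀ {d} → ℕ → Property d → RandomizedAlgorithm d → Set
OneSided {d} t P T =
  ∀ (f : BoolFun d) (σ : Strategy t d) → P f → Pr[accept] T f σ ≡ 1ℚ

------------------------------------------------------------------------
-- The bounds, with their real-valued expressions cleared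

-- t ≤ c · ε^(5/4) · 2^(d/4) for c, ε ≥ 0: both sides raised to the power 4.
ErasureBudget : ℚ → ℕ → ℕ → ℚ → Set
ErasureBudget c d t ε = fromℕ t ^ 4 ≤ c ^ 4 * ε ^ 5 * fromℕ 2 ^ d

-- y ≤ C · log₂ x for y ≥ 0 and x > 0: with y = m / n in lowest terms, this
-- says 2 ^ m ≤ x ^ (C · n).
_≤_·log₂_ : ℚ → ℕ → ℚ → Set
y ≤ C ·log₂ x = fromℕ 2 ^ ∣ ↥ y ∣ ≤ x ^ (C ℕ.* ↧ₙ y)

-- log (t / ε) is undefined at t = 0, where t is read as 2. (Reading it as 1
-- would be too small: for d = 0 and ε close to 1 one query is still needed,
-- while log (1 / ε) tends to 0.)
logBudget : ℕ → ℕ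
logBudget zero      = 2
logBudget t@(suc _) = t

-- q ≤ C · (1 / ε) · log₂ (t / ε), multiplied by ε.
WithinQueryBudget : ℕ → ℕ → ℕ → (ε : ℚ) → .{{_ : NonZero ε}} → Set
WithinQueryBudget C q t ε = (fromℕ q * ε) ≤ C ·log₂ (fromℕ (logBudget t) ÷ ε)

{-# OPTIONS --safe #-}
-- In one iteration the tester queries k independent pairs of uniform points (k even), selects one point of
-- each pair by secret bits, queries the sum of the selected points, and compares it with the sum of their
-- values. The selected points are uniform and independent, and by Fourier analysis the test fails with
-- probability at least ε / 2: with F = (-1)^f its bias is Σ_S F̂(S)^(k + 1), which is at most max F̂ because
-- k is even, F̂² ≤ 1 and Σ F̂² = 1. The adversary sees the pairs but not the bits, so it would have to erase a
-- constant fraction of the 2^k possible sums, and these are almost all distinct. With 2^k of the order of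
-- (t / ε)^4 the expected number of erased answers in O(1 / ε) iterations is a small constant, and the two
-- failure probabilities add up to at most 1/3.
module Submission where

open import Defs
open import Algebra.Bundles using (CommutativeRing; CommutativeSemiring)
open import Data.Bool.Base using (Bool; true; false; not; _xor_; _∧_; _∨_; if_then_else_)
import Data.Bool.Properties as Bool
open import Data.Empty using (⊥-elim)
open import Data.Integer.Base as ℤ using (ℤ; ∣_∣)
import Data.Integer.Properties as ℤ
open import Data.List.Base using (List; []; _∷_; _++_; length; foldl; map; lookup; filter; filterᵇ; tabulate; allFin; cartesianProduct; cartesianProductWith)
import Data.List.Membership.DecPropositional as DecMembership
import Data.List.Properties as List
open import Data.Maybe.Base using (just; nothing)
open import Data.Nat.Base as ℕ using (ℕ; zero; suc; z≤n; s≤s)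
import Data.Nat.DivMod as ℕ
import Data.Nat.Properties as ℕ
open import Data.Product.Base using (Σ-syntax; ∃; ∃-syntax; _×_; _,_; proj₁; proj₂)
open import Data.Rational.Base as ℚ using (ℚ; mkℚ; 0ℚ; 1ℚ; _/_; _÷_; 1/_; ↥_; ↧_; ↧ₙ_; Positive; NonNegative; NonZero)
import Data.Rational.Properties as ℚ
open import Data.Rational.Properties using (pos⇒nonZero)
open import Data.Rational.Solver using (module +-*-Solver)
open import Data.Rational.Unnormalised.Base as ℚᵘ using (mkℚᵘ; *≡*)
import Data.Rational.Unnormalised.Properties as ℚᵘ
open import Data.Sum.Base using (_⊎_; inj₁; inj₂)
open import Data.Unit.Base using (tt)
open import Data.Vec.Base as Vec using (Vec; []; _∷_; replicate; foldr′)
open import Data.Vec.Bounded.Base as Vec≤ using (Vec≤)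
import Data.Vec.Properties as Vec
open import Function.Base using (id)
open import Level using (Level)
open import Relation.Nullary using (¬_; Dec; yes; no)
open import Relation.Nullary.Decidable using (does; toWitness)
open import Relation.Unary using (Decidable)
open import Algebra.Properties.CommutativeSemigroup (CommutativeRing.+-commutativeSemigroup Bool.xor-∧-commutativeRing) using () renaming (interchange to xor-interchange)
open import Algebra.Properties.CommutativeSemiring.Exp (CommutativeRing.commutativeSemiring ℚ.+-*-commutativeRing) using (^-distrib-*; ^-assocʳ)

-- Every estimate is a count over an explicit list of outcomes with denominators cleared: `D` is
-- `2 ^ d`, and an integer `n` of the order of 1/ε replaces 1/ε. The obstacle is that the adversary
-- is adaptive, so that the answers given in different iterations are not independent. The remedy is
-- a union bound: a run accepts only if the run without erasures accepts or some query meets an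
-- erased point. The first event is a product over the iterations. The second is bounded in
-- expectation, and there a strategy matters only through the number of points erased so far. Let M
-- bound that number over the whole run. An iteration then costs at most 2kM/D for its uniform
-- queries, M/2^k for an erased sum and 2^k/D for colliding sums, and N iterations, with N of the
-- order of n, may cost only a constant. Since M is of the order of n t k, the second cost asks for
-- 2^k well above n^2 t k, and the third for D well above n 2^k. With 2^k of the order of (t n)^4
-- the latter reads t^4 n^5 ≤ c 2^d, which is the erasure budget raised to the fourth power.

infixl 6 _⊕_

_⊕_ : ∀ {d} → Cube d → Cube d → Cube d
_⊕_ = Vec.zipWith _xor_

vectors : ∀ {a} {A : Set a} → List A → ∀ k → List (Vec A k)
vectors xs zero    = [] ∷ []
vectors xs (suc k) = cartesianProductWith _∷_ xs (vectors xs k)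

-- Finite sums over lists in a commutative semiring

module Summation {r ℓ} (R : CommutativeSemiring r ℓ) where
  open CommutativeSemiring R
  open import Algebra.Properties.CommutativeSemigroup +-commutativeSemigroup using (interchange)
  open import Relation.Binary.Reasoning.Setoid setoid

  private variable
    a : Level
    A B C : Set a

  ∑ : List A → (A → Carrier) → Carrier
  ∑ []       f = 0#
  ∑ (x ∷ xs) f = f x + ∑ xs f

  ∑-cong : ∀ (xs : List A) {f g : A → Carrier} → (∀ x → f x ≈ g x) → ∑ xs f ≈ ∑ xs g
  ∑-cong []       f≈g = refl
  ∑-cong (x ∷ xs) f≈g = +-cong (f≈g x) (∑-cong xs f≈g)

  ∑-zero : ∀ (xs : List A) → ∑ xs (λ _ → 0#) ≈ 0#
  ∑-zero []       = refl
  ∑-zero (x ∷ xs) = trans (+-identityˡ _) (∑-zero xs)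

  ∑-+ : ∀ (xs : List A) (f g : A → Carrier) → ∑ xs (λ x → f x + g x) ≈ ∑ xs f + ∑ xs g
  ∑-+ []       f g = sym (+-identityˡ 0#)
  ∑-+ (x ∷ xs) f g = trans (+-congˡ (∑-+ xs f g)) (interchange (f x) (g x) _ _)

  ∑-*ˡ : ∀ (xs : List A) y (f : A → Carrier) → ∑ xs (λ x → y * f x) ≈ y * ∑ xs f
  ∑-*ˡ []       y f = sym (zeroʳ y)
  ∑-*ˡ (x ∷ xs) y f = trans (+-congˡ (∑-*ˡ xs y f)) (sym (distribˡ y _ _))

  ∑-*ʳ : ∀ (xs : List A) y (f : A → Carrier) → ∑ xs (λ x → f x * y) ≈ ∑ xs f * y
  ∑-*ʳ xs y f = begin
    ∑ xs (λ x → f x * y)  ≈⟨ ∑-cong xs (λ x → *-comm (f x) y) ⟩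
    ∑ xs (λ x → y * f x)  ≈⟨ ∑-*ˡ xs y f ⟩
    y * ∑ xs f            ≈⟨ *-comm y _ ⟩
    ∑ xs f * y            ∎

  ∑-swap : ∀ (xs : List A) (ys : List B) (f : A → B → Carrier) →
           ∑ xs (λ x → ∑ ys (λ y → f x y)) ≈ ∑ ys (λ y → ∑ xs (λ x → f x y))
  ∑-swap []       ys f = sym (∑-zero ys)
  ∑-swap (x ∷ xs) ys f = trans (+-congˡ (∑-swap xs ys f)) (sym (∑-+ ys (f x) _))

  ∑-++ : ∀ (xs ys : List A) (f : A → Carrier) → ∑ (xs ++ ys) f ≈ ∑ xs f + ∑ ys f
  ∑-++ []       ys f = sym (+-identityˡ _)
  ∑-++ (x ∷ xs) ys f = trans (+-congˡ (∑-++ xs ys f)) (sym (+-assoc _ _ _))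

  ∑-map : ∀ (h : A → B) xs (f : B → Carrier) → ∑ (map h xs) f ≈ ∑ xs (λ x → f (h x))
  ∑-map h []       f = refl
  ∑-map h (x ∷ xs) f = +-congˡ (∑-map h xs f)

  ∑-cartesian : ∀ (h : A → B → C) xs ys (f : C → Carrier) →
                ∑ (cartesianProductWith h xs ys) f ≈ ∑ xs (λ x → ∑ ys (λ y → f (h x y)))
  ∑-cartesian h []       ys f = refl
  ∑-cartesian h (x ∷ xs) ys f =
    trans (∑-++ (map (h x) ys) _ f) (+-cong (∑-map (h x) ys f) (∑-cartesian h xs ys f))

  ∑-points : ∀ d (f : Cube (suc d) → Carrier) →
             ∑ (points (suc d)) f ≈
             ∑ (points d) (λ x → f (false ∷ x)) + ∑ (points d) (λ x → f (true ∷ x))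
  ∑-points d f = trans (∑-++ (map (false ∷_) (points d)) _ f)
                       (+-cong (∑-map _ (points d) f) (∑-map _ (points d) f))

  -- A `true` coordinate of `y` swaps the two halves of the cube, a `false` one keeps them.
  ∑-translate : ∀ d (y : Cube d) (f : Cube d → Carrier) →
                ∑ (points d) (λ x → f (y ⊕ x)) ≈ ∑ (points d) f
  ∑-translate zero    []          f = refl
  ∑-translate (suc d) (false ∷ y) f = begin
    ∑ (points (suc d)) (λ x → f ((false ∷ y) ⊕ x))  ≈⟨ ∑-points d _ ⟩
    _  ≈⟨ +-cong (∑-translate d y _) (∑-translate d y _) ⟩
    _  ≈⟨ ∑-points d f ⟨
    ∑ (points (suc d)) f                             ∎
  ∑-translate (suc d) (true ∷ y) f = begin
    ∑ (points (suc d)) (λ x → f ((true ∷ y) ⊕ x))   ≈⟨ ∑-points d _ ⟩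
    _  ≈⟨ +-cong (∑-translate d y _) (∑-translate d y _) ⟩
    _  ≈⟨ +-comm _ _ ⟩
    _  ≈⟨ ∑-points d f ⟨
    ∑ (points (suc d)) f                             ∎

open import Relation.Binary.PropositionalEquality using (_≡_; refl; sym; trans; cong; cong₂; subst; subst₂; module ≡-Reasoning)

module ∑ℕ = Summation ℕ.+-*-commutativeSemiring
module ∑ℤ = Summation ℤ.+-*-commutativeSemiring

-- Fourier analysis on the cube

module _ where
  open import Data.Integer.Base using (+_; -[1+_]; +≤+)
  open import Data.Integer.Tactic.RingSolver using (solve-∀)
  open ∑ℕ using (∑)

  private variable
    a : Level
    A : Set a

  ⟦_⟧ : Bool → ℕ
  ⟦ false ⟧ = 0
  ⟦ true  ⟧ = 1

  ∑-mono-≤ : ∀ (xs : List A) {f g : A → ℕ} → (∀ x → f x ℕ.≤ g x) → ∑ xs f ℕ.≤ ∑ xs g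
  ∑-mono-≤ []       f≤g = ℕ.z≤n
  ∑-mono-≤ (x ∷ xs) f≤g = ℕ.+-mono-≤ (f≤g x) (∑-mono-≤ xs f≤g)

  ∑-const : ∀ (xs : List A) c → ∑ xs (λ _ → c) ≡ length xs ℕ.* c
  ∑-const []       c = refl
  ∑-const (x ∷ xs) c = cong (c ℕ.+_) (∑-const xs c)

  ∑-1 : ∀ (xs : List A) → ∑ xs (λ _ → 1) ≡ length xs
  ∑-1 xs = trans (∑-const xs 1) (ℕ.*-identityʳ (length xs))

  ∑-points-const : ∀ d c → ∑ (points d) (λ _ → c) ≡ 2 ℕ.^ d ℕ.* c
  ∑-points-const zero    c = refl
  ∑-points-const (suc d) c = begin
    ∑ (points (suc d)) (λ _ → c)                            ≡⟨ ∑ℕ.∑-points d _ ⟩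
    ∑ (points d) (λ _ → c) ℕ.+ ∑ (points d) (λ _ → c)       ≡⟨ cong₂ ℕ._+_ (∑-points-const d c) (∑-points-const d c) ⟩
    2 ℕ.^ d ℕ.* c ℕ.+ 2 ℕ.^ d ℕ.* c                         ≡⟨ ℕ.*-distribʳ-+ c (2 ℕ.^ d) _ ⟨
    (2 ℕ.^ d ℕ.+ 2 ℕ.^ d) ℕ.* c                             ≡⟨ cong (λ D → (2 ℕ.^ d ℕ.+ D) ℕ.* c) (ℕ.+-identityʳ _) ⟨
    2 ℕ.^ suc d ℕ.* c                                       ∎
    where open ≡-Reasoning

  ∑-vectors-const : ∀ (xs : List A) k c → ∑ (vectors xs k) (λ _ → c) ≡ length xs ℕ.^ k ℕ.* c
  ∑-vectors-const xs zero    c = refl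
  ∑-vectors-const xs (suc k) c = begin
    ∑ (vectors xs (suc k)) (λ _ → c)              ≡⟨ ∑ℕ.∑-cartesian _∷_ xs (vectors xs k) _ ⟩
    ∑ xs (λ _ → ∑ (vectors xs k) (λ _ → c))       ≡⟨ ∑-const xs _ ⟩
    length xs ℕ.* ∑ (vectors xs k) (λ _ → c)      ≡⟨ cong (length xs ℕ.*_) (∑-vectors-const xs k c) ⟩
    length xs ℕ.* (length xs ℕ.^ k ℕ.* c)         ≡⟨ ℕ.*-assoc (length xs) _ c ⟨
    length xs ℕ.^ suc k ℕ.* c                     ∎
    where open ≡-Reasoning

  length-points : ∀ d → length (points d) ≡ 2 ℕ.^ d
  length-points d = trans (sym (∑-1 (points d))) (trans (∑-points-const d 1) (ℕ.*-identityʳ (2 ℕ.^ d)))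

  pos-∑ : ∀ (xs : List A) (f : A → ℕ) → + ∑ xs f ≡ ∑ℤ.∑ xs (λ x → + f x)
  pos-∑ []       f = refl
  pos-∑ (x ∷ xs) f = cong (ℤ._+_ (+ f x)) (pos-∑ xs f)

  ∑ℤ-mono-≤ : ∀ (xs : List A) {f g : A → ℤ} → (∀ x → f x ℤ.≤ g x) → ∑ℤ.∑ xs f ℤ.≤ ∑ℤ.∑ xs g
  ∑ℤ-mono-≤ []       f≤g = ℤ.≤-refl
  ∑ℤ-mono-≤ (x ∷ xs) f≤g = ℤ.+-mono-≤ (f≤g x) (∑ℤ-mono-≤ xs f≤g)

  ∣∑∣≤∑∣∣ : ∀ (xs : List A) (f : A → ℤ) → ∣ ∑ℤ.∑ xs f ∣ ℕ.≤ ∑ xs (λ x → ∣ f x ∣)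
  ∣∑∣≤∑∣∣ []       f = ℕ.z≤n
  ∣∑∣≤∑∣∣ (x ∷ xs) f = ℕ.≤-trans (ℤ.∣i+j∣≤∣i∣+∣j∣ (f x) _) (ℕ.+-monoʳ-≤ _ (∣∑∣≤∑∣∣ xs f))

  zeros : ∀ {d} → Cube d
  zeros = replicate _ false

  total : ∀ {d k} → Vec (Cube d) k → Cube d
  total = foldr′ _⊕_ zeros

  values : ∀ {d k} → BoolFun d → Vec (Cube d) k → Bool
  values f []       = false
  values f (z ∷ zs) = f z xor values f zs

  parity-⊕ : ∀ {d} (S x y : Cube d) → parity S (x ⊕ y) ≡ parity S x xor parity S y
  parity-⊕ []      []      []      = refl
  parity-⊕ (s ∷ S) (x ∷ xs) (y ∷ ys) = begin
    (s ∧ (x xor y)) xor parity S (xs ⊕ ys)                  ≡⟨ cong₂ _xor_ (Bool.∧-distribˡ-xor s x y) (parity-⊕ S xs ys) ⟩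
    ((s ∧ x) xor (s ∧ y)) xor (parity S xs xor parity S ys)  ≡⟨ xor-interchange (s ∧ x) (s ∧ y) _ _ ⟩
    parity (s ∷ S) (x ∷ xs) xor parity (s ∷ S) (y ∷ ys)      ∎
    where open ≡-Reasoning

  sign : Bool → ℤ
  sign false = + 1
  sign true  = -[1+ 0 ]

  sign-xor : ∀ a b → sign (a xor b) ≡ sign a ℤ.* sign b
  sign-xor false b     = sym (ℤ.*-identityˡ (sign b))
  sign-xor true  false = refl
  sign-xor true  true  = refl

  sign≤1 : ∀ b → sign b ℤ.≤ + 1
  sign≤1 false = ℤ.≤-refl
  sign≤1 true  = ℤ.-≤+

  ∣sign∣ : ∀ b → ∣ sign b ∣ ≡ 1
  ∣sign∣ false = refl
  ∣sign∣ true  = refl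

  sign+xor≤1 : ∀ b → sign b ℤ.+ + ⟦ b ⟧ ℤ.≤ + 1
  sign+xor≤1 false = ℤ.≤-refl
  sign+xor≤1 true  = +≤+ ℕ.z≤n

  2⟦not⟧ : ∀ b → + 2 ℤ.* + ⟦ not b ⟧ ≡ + 1 ℤ.+ sign b
  2⟦not⟧ false = refl
  2⟦not⟧ true  = refl

  χ : ∀ {d} → Cube d → Cube d → ℤ
  χ S x = sign (parity S x)

  χ-⊕ : ∀ {d} (S x y : Cube d) → χ S (x ⊕ y) ≡ χ S x ℤ.* χ S y
  χ-⊕ S x y = trans (cong sign (parity-⊕ S x y)) (sign-xor (parity S x) _)

  -- The Fourier coefficient without its normalisation `1 / 2 ^ d`, which keeps the analysis in the
  -- integers.
  transform : ∀ {d} → (Cube d → ℤ) → Cube d → ℤ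
  transform {d} H S = ∑ℤ.∑ (points d) (λ x → H x ℤ.* χ S x)

  ⊕-cancelˡ : ∀ {d} (x y : Cube d) → x ⊕ (x ⊕ y) ≡ y
  ⊕-cancelˡ []          []      = refl
  ⊕-cancelˡ (false ∷ x) (y ∷ ys) = cong (y ∷_) (⊕-cancelˡ x ys)
  ⊕-cancelˡ (true ∷ x)  (false ∷ ys) = cong (false ∷_) (⊕-cancelˡ x ys)
  ⊕-cancelˡ (true ∷ x)  (true ∷ ys) = cong (true ∷_) (⊕-cancelˡ x ys)

  module _ where
    open ∑ℤ using (∑-cong; ∑-+; ∑-*ˡ; ∑-*ʳ; ∑-swap; ∑-zero; ∑-points; ∑-cartesian; ∑-translate) renaming (∑ to ∑ᶻ)
    open ≡-Reasoning
    open import Data.Integer.Base using (_+_; _*_)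

    transform-translate : ∀ {d} (H : Cube d → ℤ) z S →
                          transform (λ x → H (z ⊕ x)) S ≡ χ S z * transform H S
    transform-translate {d} H z S = begin
      ∑ᶻ (points d) (λ x → H (z ⊕ x) * χ S x)
        ≡⟨ ∑-cong (points d) (λ x → cong (λ y → H (z ⊕ x) * χ S y) (⊕-cancelˡ z x)) ⟨
      ∑ᶻ (points d) (λ x → H (z ⊕ x) * χ S (z ⊕ (z ⊕ x)))
        ≡⟨ ∑-translate d z (λ x → H x * χ S (z ⊕ x)) ⟩
      ∑ᶻ (points d) (λ x → H x * χ S (z ⊕ x))
        ≡⟨ ∑-cong (points d) (λ x → trans (cong (H x *_) (χ-⊕ S z x)) (left-commute (H x) (χ S z) (χ S x))) ⟩
      ∑ᶻ (points d) (λ x → χ S z * (H x * χ S x))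
        ≡⟨ ∑-*ˡ (points d) (χ S z) _ ⟩
      χ S z * transform H S ∎
      where
      left-commute : ∀ h u v → h * (u * v) ≡ u * (h * v)
      left-commute = solve-∀

    -- Fourier inversion at the origin. The characters of `false ∷ S` and `true ∷ S` agree where the
    -- first coordinate of the point is `false` and are opposite where it is `true`, so only twice
    -- the transform of the `false` half survives.
    inversion₀ : ∀ {d} (H : Cube d → ℤ) → ∑ᶻ (points d) (transform H) ≡ + (2 ℕ.^ d) * H zeros
    inversion₀ {zero}  H = alg (H [])
      where
      alg : ∀ h → (h * + 1 + + 0) + + 0 ≡ + 1 * h
      alg = solve-∀
    inversion₀ {suc d} H = begin
      ∑ᶻ (points (suc d)) (transform H)
        ≡⟨ ∑-points d _ ⟩
      ∑ᶻ (points d) (λ S → transform H (false ∷ S)) + ∑ᶻ (points d) (λ S → transform H (true ∷ S))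
        ≡⟨ ∑-+ (points d) _ _ ⟨
      ∑ᶻ (points d) (λ S → transform H (false ∷ S) + transform H (true ∷ S))
        ≡⟨ ∑-cong (points d) fold ⟩
      ∑ᶻ (points d) (λ S → + 2 * transform H₀ S)
        ≡⟨ ∑-*ˡ (points d) (+ 2) _ ⟩
      + 2 * ∑ᶻ (points d) (transform H₀)
        ≡⟨ cong (+ 2 *_) (inversion₀ H₀) ⟩
      + 2 * (+ (2 ℕ.^ d) * H zeros)
        ≡⟨ ℤ.*-assoc (+ 2) (+ (2 ℕ.^ d)) _ ⟨
      + 2 * + (2 ℕ.^ d) * H zeros
        ≡⟨ cong (_* H zeros) (ℤ.pos-* 2 (2 ℕ.^ d)) ⟨
      + (2 ℕ.^ suc d) * H zeros ∎
      where
      H₀ H₁ : Cube d → ℤ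
      H₀ x = H (false ∷ x)
      H₁ x = H (true ∷ x)

      opposite : ∀ h b → h * sign b + h * sign (not b) ≡ + 0
      opposite h false = alg h where
        alg : ∀ h → h * + 1 + h * -[1+ 0 ] ≡ + 0
        alg = solve-∀
      opposite h true = alg h where
        alg : ∀ h → h * -[1+ 0 ] + h * + 1 ≡ + 0
        alg = solve-∀

      regroup : ∀ u v w → (u + v) + (u + w) ≡ + 2 * u + (v + w)
      regroup = solve-∀

      fold : ∀ S → transform H (false ∷ S) + transform H (true ∷ S) ≡ + 2 * transform H₀ S
      fold S = begin
        transform H (false ∷ S) + transform H (true ∷ S)
          ≡⟨ cong₂ _+_ (∑-points d _) (∑-points d _) ⟩
        (transform H₀ S + transform H₁ S) + (transform H₀ S + ∑ᶻ (points d) (λ x → H₁ x * sign (not (parity S x))))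
          ≡⟨ regroup (transform H₀ S) _ _ ⟩
        + 2 * transform H₀ S + (transform H₁ S + ∑ᶻ (points d) (λ x → H₁ x * sign (not (parity S x))))
          ≡⟨ cong (_+_ (+ 2 * transform H₀ S)) (∑-+ (points d) _ _) ⟨
        + 2 * transform H₀ S + ∑ᶻ (points d) (λ x → H₁ x * sign (parity S x) + H₁ x * sign (not (parity S x)))
          ≡⟨ cong (_+_ (+ 2 * transform H₀ S)) (trans (∑-cong (points d) (λ x → opposite (H₁ x) (parity S x))) (∑-zero (points d))) ⟩
        + 2 * transform H₀ S + + 0
          ≡⟨ ℤ.+-identityʳ _ ⟩
        + 2 * transform H₀ S ∎

    -- Each convolution with the sign of `f` contributes a factor `F̂ S`, and `inversion₀` evaluates
    -- the result at the origin. `H` is arbitrary because peeling off a point `z` replaces it by its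
    -- translate by `z`; the translate contributes `χ S z`, and the sum over `z` of `F z * χ S z` is
    -- `F̂ S`.
    convolution : ∀ {d} (f : BoolFun d) k (H : Cube d → ℤ) →
      + (2 ℕ.^ d) * ∑ᶻ (vectors (points d) k) (λ zs → sign (values f zs) * H (total zs)) ≡
      ∑ᶻ (points d) (λ S → transform (λ x → sign (f x)) S ℤ.^ k * transform H S)
    convolution {d} f zero H = begin
      + (2 ℕ.^ d) * (+ 1 * H zeros + + 0)       ≡⟨ cong (+ (2 ℕ.^ d) *_) (trans (ℤ.+-identityʳ _) (ℤ.*-identityˡ _)) ⟩
      + (2 ℕ.^ d) * H zeros                     ≡⟨ inversion₀ H ⟨
      ∑ᶻ (points d) (transform H)               ≡⟨ ∑-cong (points d) (λ S → ℤ.*-identityˡ _) ⟨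
      ∑ᶻ (points d) (λ S → + 1 * transform H S) ∎
    convolution {d} f (suc k) H = begin
      D * ∑ᶻ (vectors (points d) (suc k)) (λ zs → sign (values f zs) * H (total zs))
        ≡⟨ cong (D *_) (∑-cartesian _∷_ (points d) (vectors (points d) k) _) ⟩
      D * ∑ᶻ (points d) (λ z → ∑ᶻ (vectors (points d) k) (λ zs → sign (f z xor values f zs) * H (z ⊕ total zs)))
        ≡⟨ cong (D *_) (∑-cong (points d) (λ z → trans (∑-cong (vectors (points d) k) (λ zs → split z zs)) (∑-*ˡ (vectors (points d) k) (F z) _))) ⟩
      D * ∑ᶻ (points d) (λ z → F z * ∑ᶻ (vectors (points d) k) (λ zs → sign (values f zs) * H (z ⊕ total zs)))
        ≡⟨ ∑-*ˡ (points d) D _ ⟨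
      ∑ᶻ (points d) (λ z → D * (F z * ∑ᶻ (vectors (points d) k) (λ zs → sign (values f zs) * H (z ⊕ total zs))))
        ≡⟨ ∑-cong (points d) (λ z → trans (left-commute D (F z) _) (cong (F z *_) (convolution f k (λ x → H (z ⊕ x))))) ⟩
      ∑ᶻ (points d) (λ z → F z * ∑ᶻ (points d) (λ S → F̂ S ℤ.^ k * transform (λ x → H (z ⊕ x)) S))
        ≡⟨ ∑-cong (points d) (λ z → ∑-*ˡ (points d) (F z) _) ⟨
      ∑ᶻ (points d) (λ z → ∑ᶻ (points d) (λ S → F z * (F̂ S ℤ.^ k * transform (λ x → H (z ⊕ x)) S)))
        ≡⟨ ∑-swap (points d) (points d) _ ⟩
      ∑ᶻ (points d) (λ S → ∑ᶻ (points d) (λ z → F z * (F̂ S ℤ.^ k * transform (λ x → H (z ⊕ x)) S)))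
        ≡⟨ ∑-cong (points d) collect ⟩
      ∑ᶻ (points d) (λ S → F̂ S ℤ.^ suc k * transform H S) ∎
      where
      D = + (2 ℕ.^ d)
      F F̂ : Cube d → ℤ
      F x = sign (f x)
      F̂ = transform F

      left-commute : ∀ u v w → u * (v * w) ≡ v * (u * w)
      left-commute = solve-∀

      split : ∀ z zs → sign (f z xor values f zs) * H (z ⊕ total zs) ≡ F z * (sign (values f zs) * H (z ⊕ total zs))
      split z zs = trans (cong (_* _) (sign-xor (f z) (values f zs))) (ℤ.*-assoc (F z) _ _)

      shuffle : ∀ u p c h → u * (p * (c * h)) ≡ (u * c) * (p * h)
      shuffle = solve-∀

      collect : ∀ S → ∑ᶻ (points d) (λ z → F z * (F̂ S ℤ.^ k * transform (λ x → H (z ⊕ x)) S)) ≡ F̂ S ℤ.^ suc k * transform H S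
      collect S = begin
        ∑ᶻ (points d) (λ z → F z * (F̂ S ℤ.^ k * transform (λ x → H (z ⊕ x)) S))
          ≡⟨ ∑-cong (points d) (λ z → trans (cong (λ h → F z * (F̂ S ℤ.^ k * h)) (transform-translate H z S)) (shuffle (F z) (F̂ S ℤ.^ k) (χ S z) (transform H S))) ⟩
        ∑ᶻ (points d) (λ z → (F z * χ S z) * (F̂ S ℤ.^ k * transform H S))
          ≡⟨ ∑-*ʳ (points d) (F̂ S ℤ.^ k * transform H S) _ ⟩
        F̂ S * (F̂ S ℤ.^ k * transform H S)
          ≡⟨ ℤ.*-assoc (F̂ S) _ _ ⟨
        F̂ S ℤ.^ suc k * transform H S ∎

  disagreements : ∀ {d} → BoolFun d → Cube d → ℕ
  disagreements {d} f S = ∑ (points d) (λ x → ⟦ f x xor parity S x ⟧)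

  passes : ∀ {d k} → BoolFun d → Vec (Cube d) k → Bool
  passes f zs = not (values f zs xor f (total zs))

  i*i≡+∣i∣*∣i∣ : ∀ i → i ℤ.* i ≡ + (∣ i ∣ ℕ.* ∣ i ∣)
  i*i≡+∣i∣*∣i∣ (+ n)    = sym (ℤ.pos-* n n)
  i*i≡+∣i∣*∣i∣ -[1+ n ] = refl

  pos-^ : ∀ m k → (+ m) ℤ.^ k ≡ + (m ℕ.^ k)
  pos-^ m zero    = refl
  pos-^ m (suc k) = trans (cong (ℤ._*_ (+ m)) (pos-^ m k)) (sym (ℤ.pos-* m _))

  +-cancelˡ-≤ : ∀ k {i j} → k ℤ.+ i ℤ.≤ k ℤ.+ j → i ℤ.≤ j
  +-cancelˡ-≤ k {i} {j} k+i≤k+j = begin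
    i                      ≡⟨ cancel k i ⟩
    ℤ.- k ℤ.+ (k ℤ.+ i)    ≤⟨ ℤ.+-monoʳ-≤ (ℤ.- k) k+i≤k+j ⟩
    ℤ.- k ℤ.+ (k ℤ.+ j)    ≡⟨ cancel k j ⟨
    j                      ∎
    where
    open ℤ.≤-Reasoning
    cancel : ∀ k i → i ≡ ℤ.- k ℤ.+ (k ℤ.+ i)
    cancel = solve-∀

  module _ {d : ℕ} (f : BoolFun d) where
    open import Data.Integer.Base using (_+_; _*_; _≤_)
    open ∑ℤ using () renaming (∑ to ∑ᶻ)

    private
      D = 2 ℕ.^ d

      F F̂ : Cube d → ℤ
      F x = sign (f x)
      F̂ = transform F

      energy : Cube d → ℕ
      energy S = ∣ F̂ S ∣ ℕ.* ∣ F̂ S ∣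

      correlation : ℕ → ℤ
      correlation k = ∑ᶻ (vectors (points d) k) (λ zs → sign (values f zs) * F (total zs))

    ∑-vectors-points : ∀ k → ∑ (vectors (points d) k) (λ _ → 1) ≡ D ℕ.^ k
    ∑-vectors-points k = trans (∑-vectors-const (points d) k 1)
      (trans (ℕ.*-identityʳ _) (cong (ℕ._^ k) (length-points d)))

    correlation≤ : ∀ k → correlation k ≤ + (D ℕ.^ k)
    correlation≤ k = begin
      correlation k
        ≤⟨ ∑ℤ-mono-≤ (vectors (points d) k) (λ zs → subst (_≤ + 1) (sign-xor (values f zs) _) (sign≤1 (values f zs xor f (total zs)))) ⟩
      ∑ᶻ (vectors (points d) k) (λ _ → + 1)
        ≡⟨ pos-∑ (vectors (points d) k) (λ _ → 1) ⟨
      + ∑ (vectors (points d) k) (λ _ → 1)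
        ≡⟨ cong +_ (∑-vectors-points k) ⟩
      + (D ℕ.^ k) ∎
      where open ℤ.≤-Reasoning

    -- The case `k = 1` of `convolution` with `H = F`; the trivial bound on the correlation gives
    -- the inequality.
    parseval : ∑ (points d) energy ℕ.≤ D ℕ.* D
    parseval = ℤ.drop‿+≤+ (begin
      + ∑ (points d) energy
        ≡⟨ pos-∑ (points d) energy ⟩
      ∑ᶻ (points d) (λ S → + energy S)
        ≡⟨ ∑ℤ.∑-cong (points d) (λ S → trans (cong (_* F̂ S) (ℤ.^-identityʳ (F̂ S))) (i*i≡+∣i∣*∣i∣ (F̂ S))) ⟨
      ∑ᶻ (points d) (λ S → F̂ S ℤ.^ 1 * F̂ S)
        ≡⟨ convolution f 1 F ⟨
      + D * correlation 1
        ≤⟨ ℤ.*-monoˡ-≤-nonNeg (+ D) (correlation≤ 1) ⟩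
      + D * + (D ℕ.^ 1)
        ≡⟨ cong (λ e → + D * + e) (ℕ.^-identityʳ D) ⟩
      + D * + D
        ≡⟨ ℤ.pos-* D D ⟨
      + (D ℕ.* D) ∎)
      where open ℤ.≤-Reasoning

    ∣F̂∣≤D : ∀ S → ∣ F̂ S ∣ ℕ.≤ D
    ∣F̂∣≤D S = begin
      ∣ F̂ S ∣                                          ≤⟨ ∣∑∣≤∑∣∣ (points d) _ ⟩
      ∑ (points d) (λ x → ∣ F x * χ S x ∣)              ≡⟨ ∑ℕ.∑-cong (points d) (λ x → trans (ℤ.abs-* (F x) _) (cong₂ ℕ._*_ (∣sign∣ (f x)) (∣sign∣ (parity S x)))) ⟩
      ∑ (points d) (λ x → 1)                            ≡⟨ trans (∑-points-const d 1) (ℕ.*-identityʳ D) ⟩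
      D                                                 ∎
      where open ℕ.≤-Reasoning

    energy-^ : ∀ j S → energy S ℕ.^ suc j ℕ.≤ (D ℕ.* D) ℕ.^ j ℕ.* energy S
    energy-^ j S = begin
      energy S ℕ.* energy S ℕ.^ j        ≡⟨ ℕ.*-comm (energy S) _ ⟩
      energy S ℕ.^ j ℕ.* energy S        ≤⟨ ℕ.*-monoˡ-≤ (energy S) (ℕ.^-monoˡ-≤ j (ℕ.*-mono-≤ (∣F̂∣≤D S) (∣F̂∣≤D S))) ⟩
      (D ℕ.* D) ℕ.^ j ℕ.* energy S       ∎
      where open ℕ.≤-Reasoning

    -- The reason for an even `k`: the weights `F̂ S ^ k` are nonnegative, so an upper bound for the
    -- remaining factor `F̂ S` may be multiplied by them. Farness gives no lower bound for `F̂ S`: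
    -- the complement of a linear function is far from linear and has a coefficient equal to `- D`.
    F̂-even-power : ∀ j S → F̂ S ℤ.^ (2 ℕ.* j) ≡ + (energy S ℕ.^ j)
    F̂-even-power j S = begin
      F̂ S ℤ.^ (2 ℕ.* j)          ≡⟨ ℤ.^-*-assoc (F̂ S) 2 j ⟨
      (F̂ S ℤ.^ 2) ℤ.^ j          ≡⟨ cong (λ e → (F̂ S * e) ℤ.^ j) (ℤ.*-identityʳ (F̂ S)) ⟩
      (F̂ S * F̂ S) ℤ.^ j          ≡⟨ cong (ℤ._^ j) (i*i≡+∣i∣*∣i∣ (F̂ S)) ⟩
      (+ energy S) ℤ.^ j          ≡⟨ pos-^ (energy S) j ⟩
      + (energy S ℕ.^ j)          ∎
      where open ≡-Reasoning

    -- Pointwise, since a disagreement turns the sign from 1 to -1. Twice the disagreements could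
    -- stand here; the factor given away is why an iteration is shown to fail with probability ε/2
    -- and not ε.
    F̂+disagreements≤D : ∀ S → F̂ S + + disagreements f S ≤ + D
    F̂+disagreements≤D S = begin
      F̂ S + + disagreements f S
        ≡⟨ cong (_+_ (F̂ S)) (pos-∑ (points d) _) ⟩
      F̂ S + ∑ᶻ (points d) (λ x → + ⟦ f x xor parity S x ⟧)
        ≡⟨ ∑ℤ.∑-+ (points d) _ _ ⟨
      ∑ᶻ (points d) (λ x → F x * χ S x + + ⟦ f x xor parity S x ⟧)
        ≤⟨ ∑ℤ-mono-≤ (points d) (λ x → subst (λ e → e + + ⟦ f x xor parity S x ⟧ ≤ + 1) (sign-xor (f x) _) (sign+xor≤1 (f x xor parity S x))) ⟩
      ∑ᶻ (points d) (λ x → + 1)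
        ≡⟨ pos-∑ (points d) (λ _ → 1) ⟨
      + ∑ (points d) (λ _ → 1)
        ≡⟨ cong +_ (trans (∑-points-const d 1) (ℕ.*-identityʳ D)) ⟩
      + D ∎
      where open ℤ.≤-Reasoning

    module _ {n : ℕ} (far : ∀ S → D ℕ.≤ suc n ℕ.* disagreements f S) where

      F̂-far : ∀ S → + suc n * F̂ S ≤ + (n ℕ.* D)
      F̂-far S = +-cancelˡ-≤ (+ D) (begin
        + D + + suc n * F̂ S
          ≤⟨ ℤ.+-monoˡ-≤ (+ suc n * F̂ S) (+≤+ (far S)) ⟩
        + (suc n ℕ.* disagreements f S) + + suc n * F̂ S
          ≡⟨ cong (_+ + suc n * F̂ S) (ℤ.pos-* (suc n) _) ⟩
        + suc n * + disagreements f S + + suc n * F̂ S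
          ≡⟨ factor (+ suc n) (+ disagreements f S) (F̂ S) ⟩
        + suc n * (F̂ S + + disagreements f S)
          ≤⟨ ℤ.*-monoˡ-≤-nonNeg (+ suc n) (F̂+disagreements≤D S) ⟩
        + suc n * + D
          ≡⟨ ℤ.pos-* (suc n) D ⟨
        + D + + (n ℕ.* D) ∎)
        where
        open ℤ.≤-Reasoning
        factor : ∀ a b c → a * b + a * c ≡ a * (c + b)
        factor = solve-∀

      -- In the sum of `F̂ S ^ k * F̂ S` the last factor is replaced by its bound from farness. Of
      -- the `suc j` squares in `F̂ S ^ k`, all but one are bounded by `D * D`, and the remaining
      -- one is summed by `parseval`.
      correlation-far : ∀ j → + suc n * correlation (2 ℕ.* suc j) ≤ + (n ℕ.* D ℕ.^ (2 ℕ.* suc j))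
      correlation-far j = ℤ.*-cancelˡ-≤-pos _ _ (+ D) {{ℤ.positive (ℤ.+<+ (ℕ.m^n>0 2 d))}} (begin
        + D * (+ suc n * correlation k)
          ≡⟨ left-commute (+ D) (+ suc n) (correlation k) ⟩
        + suc n * (+ D * correlation k)
          ≡⟨ cong (_*_ (+ suc n)) (convolution f k F) ⟩
        + suc n * ∑ᶻ (points d) (λ S → F̂ S ℤ.^ k * F̂ S)
          ≡⟨ ∑ℤ.∑-*ˡ (points d) (+ suc n) _ ⟨
        ∑ᶻ (points d) (λ S → + suc n * (F̂ S ℤ.^ k * F̂ S))
          ≡⟨ ∑ℤ.∑-cong (points d) (λ S → trans (left-commute (+ suc n) (F̂ S ℤ.^ k) (F̂ S)) (cong (_* (+ suc n * F̂ S)) (F̂-even-power (suc j) S))) ⟩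
        ∑ᶻ (points d) (λ S → + (energy S ℕ.^ suc j) * (+ suc n * F̂ S))
          ≤⟨ ∑ℤ-mono-≤ (points d) (λ S → ℤ.*-monoˡ-≤-nonNeg (+ (energy S ℕ.^ suc j)) (F̂-far S)) ⟩
        ∑ᶻ (points d) (λ S → + (energy S ℕ.^ suc j) * + (n ℕ.* D))
          ≡⟨ trans (pos-∑ (points d) _) (∑ℤ.∑-cong (points d) (λ S → ℤ.pos-* (energy S ℕ.^ suc j) (n ℕ.* D))) ⟨
        + ∑ (points d) (λ S → energy S ℕ.^ suc j ℕ.* (n ℕ.* D))
          ≤⟨ +≤+ energy-bound ⟩
        + (D ℕ.* (n ℕ.* D ℕ.^ k))
          ≡⟨ ℤ.pos-* D (n ℕ.* D ℕ.^ k) ⟩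
        + D * + (n ℕ.* D ℕ.^ k) ∎)
        where
        open ℤ.≤-Reasoning
        k = 2 ℕ.* suc j
        left-commute : ∀ u v w → u * (v * w) ≡ v * (u * w)
        left-commute = solve-∀
        energy-bound : ∑ (points d) (λ S → energy S ℕ.^ suc j ℕ.* (n ℕ.* D)) ℕ.≤ D ℕ.* (n ℕ.* D ℕ.^ k)
        energy-bound = R.begin
          ∑ (points d) (λ S → energy S ℕ.^ suc j ℕ.* (n ℕ.* D))
            R.≡⟨ ∑ℕ.∑-*ʳ (points d) (n ℕ.* D) _ ⟩
          ∑ (points d) (λ S → energy S ℕ.^ suc j) ℕ.* (n ℕ.* D)
            R.≤⟨ ℕ.*-monoˡ-≤ (n ℕ.* D) (∑-mono-≤ (points d) (energy-^ j)) ⟩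
          ∑ (points d) (λ S → (D ℕ.* D) ℕ.^ j ℕ.* energy S) ℕ.* (n ℕ.* D)
            R.≡⟨ cong (ℕ._* (n ℕ.* D)) (∑ℕ.∑-*ˡ (points d) ((D ℕ.* D) ℕ.^ j) energy) ⟩
          (D ℕ.* D) ℕ.^ j ℕ.* ∑ (points d) energy ℕ.* (n ℕ.* D)
            R.≤⟨ ℕ.*-monoˡ-≤ (n ℕ.* D) (ℕ.*-monoʳ-≤ ((D ℕ.* D) ℕ.^ j) parseval) ⟩
          (D ℕ.* D) ℕ.^ j ℕ.* (D ℕ.* D) ℕ.* (n ℕ.* D)
            R.≡⟨ cong (ℕ._* (n ℕ.* D)) (trans (ℕ.*-comm ((D ℕ.* D) ℕ.^ j) _) (sym D^k)) ⟩
          D ℕ.^ k ℕ.* (n ℕ.* D)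
            R.≡⟨ trans (ℕ.*-comm (D ℕ.^ k) _) (trans (cong (ℕ._* D ℕ.^ k) (ℕ.*-comm n D)) (ℕ.*-assoc D n _)) ⟩
          D ℕ.* (n ℕ.* D ℕ.^ k) R.∎
          where
          module R = ℕ.≤-Reasoning
          D^k : D ℕ.^ k ≡ (D ℕ.* D) ℕ.^ suc j
          D^k = trans (sym (ℕ.^-*-assoc D 2 (suc j))) (cong (λ e → (D ℕ.* e) ℕ.^ suc j) (ℕ.*-identityʳ D))

      -- The indicator of passing is half of 1 plus a sign, so the gap `1 / suc n` in the
      -- correlation is halved. The ratio has the form `m / suc m` with `m = 2 n + 1`, as
      -- `power-decay` expects.
      passes-far : ∀ j → let k = 2 ℕ.* suc j in
                   suc (suc (n ℕ.+ n)) ℕ.* ∑ (vectors (points d) k) (λ zs → ⟦ passes f zs ⟧) ℕ.≤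
                   suc (n ℕ.+ n) ℕ.* D ℕ.^ k
      passes-far j = ℤ.drop‿+≤+ (begin
        + (suc (suc (n ℕ.+ n)) ℕ.* passing)
          ≡⟨ cong (λ e → + (suc e ℕ.* passing)) (ℕ.+-suc n n) ⟨
        + ((suc n ℕ.+ suc n) ℕ.* passing)
          ≡⟨ ℤ.pos-* (suc n ℕ.+ suc n) passing ⟩
        + (suc n ℕ.+ suc n) * + passing
          ≡⟨ cong (_* + passing) (ℤ.pos-+ (suc n) (suc n)) ⟩
        (+ suc n + + suc n) * + passing
          ≡⟨ double (+ suc n) (+ passing) ⟩
        + suc n * (+ 2 * + passing)
          ≡⟨ cong (_*_ (+ suc n)) passing-correlation ⟩
        + suc n * (+ (D ℕ.^ k) + correlation k)
          ≡⟨ ℤ.*-distribˡ-+ (+ suc n) (+ (D ℕ.^ k)) (correlation k) ⟩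
        + suc n * + (D ℕ.^ k) + + suc n * correlation k
          ≤⟨ ℤ.+-monoʳ-≤ (+ suc n * + (D ℕ.^ k)) (correlation-far j) ⟩
        + suc n * + (D ℕ.^ k) + + (n ℕ.* D ℕ.^ k)
          ≡⟨ cong (_+ + (n ℕ.* D ℕ.^ k)) (ℤ.pos-* (suc n) (D ℕ.^ k)) ⟨
        + (suc n ℕ.* D ℕ.^ k ℕ.+ n ℕ.* D ℕ.^ k)
          ≡⟨ cong +_ (ℕ.*-distribʳ-+ (D ℕ.^ k) (suc n) n) ⟨
        + (suc (n ℕ.+ n) ℕ.* D ℕ.^ k) ∎)
        where
        open ℤ.≤-Reasoning
        k = 2 ℕ.* suc j
        vs = vectors (points d) k
        passing = ∑ vs (λ zs → ⟦ passes f zs ⟧)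
        double : ∀ a b → (a + a) * b ≡ a * (+ 2 * b)
        double = solve-∀
        passing-correlation : + 2 * + passing ≡ + (D ℕ.^ k) + correlation k
        passing-correlation = R.begin
          + 2 * + passing
            R.≡⟨ cong (_*_ (+ 2)) (pos-∑ vs _) ⟩
          + 2 * ∑ᶻ vs (λ zs → + ⟦ passes f zs ⟧)
            R.≡⟨ ∑ℤ.∑-*ˡ vs (+ 2) _ ⟨
          ∑ᶻ vs (λ zs → + 2 * + ⟦ passes f zs ⟧)
            R.≡⟨ ∑ℤ.∑-cong vs (λ zs → trans (2⟦not⟧ (values f zs xor f (total zs))) (cong (_+_ (+ 1)) (sign-xor (values f zs) _))) ⟩
          ∑ᶻ vs (λ zs → + 1 + sign (values f zs) * F (total zs))
            R.≡⟨ ∑ℤ.∑-+ vs _ _ ⟩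
          ∑ᶻ vs (λ _ → + 1) + correlation k
            R.≡⟨ cong (_+ correlation k) (trans (sym (pos-∑ vs (λ _ → 1))) (cong +_ (∑-vectors-points k))) ⟩
          + (D ℕ.^ k) + correlation k R.∎
          where module R = ≡-Reasoning

-- Executions against an erasing adversary

module _ where
  open import Data.Nat.Base using (_+_; _*_; _≤_)
  open import Data.Maybe.Base using (zipWith)
  open import Data.Nat.Tactic.RingSolver using (solve-∀)
  open ∑ℕ using (∑; ∑-cong; ∑-+; ∑-*ˡ; ∑-*ʳ; ∑-swap; ∑-cartesian)

  δ : ∀ {d} → Cube d → Cube d → ℕ
  δ x y = ⟦ does (x ≟ y) ⟧

  run : ∀ {d} → BoolFun d → Algorithm d → Bool
  run f (output b)  = b
  run f (query x k) = run f (k (just (f x)))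

  ⟦⟧≤1 : ∀ b → ⟦ b ⟧ ≤ 1
  ⟦⟧≤1 false = z≤n
  ⟦⟧≤1 true  = ℕ.≤-refl

  Truthful : ∀ {d} → BoolFun d → Oracle d → Set
  Truthful f O = ∀ x → O x ≡ just (f x) ⊎ O x ≡ nothing

  erase-truthful : ∀ {d} {f : BoolFun d} xs {O} → Truthful f O → Truthful f (erase xs O)
  erase-truthful xs truthful x with does (DecMembership._∈?_ _≟_ x xs)
  ... | true  = inj₂ refl
  ... | false = truthful x

  missing : Answer → ℕ
  missing nothing  = 1
  missing (just _) = 0

  State : ℕ → Set
  State d = History d × Oracle d

  erased : ∀ {d} → State d → ℕ
  erased {d} (h , O) = ∑ (points d) (λ x → missing (O x))

  module _ {t d : ℕ} (σ : Strategy t d) where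

    step : State d → Cube d → State d
    step (h , O) x = h′ , erase (Vec≤.toList (σ h′)) O
      where h′ = (x , O x) ∷ h

    -- The strategy is deterministic, so a fixed list of queries determines all erasures along it,
    -- and the answers met can be studied apart from the algorithm.
    hits : State d → List (Cube d) → ℕ
    hits s []       = 0
    hits s (x ∷ xs) = missing (proj₂ s x) + hits (step s x) xs

    hits-++ : ∀ s xs ys → hits s (xs ++ ys) ≡ hits s xs + hits (foldl step s xs) ys
    hits-++ s []       ys = refl
    hits-++ s (x ∷ xs) ys = trans (cong (missing (proj₂ s x) +_) (hits-++ (step s x) xs ys)) (sym (ℕ.+-assoc (missing (proj₂ s x)) _ _))

    -- Until the first erased answer the execution coincides with `run`; that answer counts one hit,
    -- which already dominates the outcome of whatever follows.
    execute≤run+hits : ∀ {f alg xs} → Asks alg xs → ∀ h O → Truthful f O →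
                       ⟦ execute σ h O alg ⟧ ≤ ⟦ run f alg ⟧ + hits (h , O) xs
    execute≤run+hits output h O truthful = ℕ.m≤m+n _ _
    execute≤run+hits {f} {query x k} (query asks) h O truthful with O x | truthful x
    ... | _ | inj₁ refl = execute≤run+hits (asks _) _ _ (erase-truthful (Vec≤.toList (σ ((x , just (f x)) ∷ h))) truthful)
    ... | _ | inj₂ refl = ℕ.≤-trans (⟦⟧≤1 (execute σ _ _ (k nothing)))
                                    (ℕ.≤-trans (s≤s z≤n) (ℕ.m≤n+m _ ⟦ run f (query x k) ⟧))

  ∑-δ : ∀ {d} (y : Cube d) (g : Cube d → ℕ) → ∑ (points d) (λ x → δ y x * g x) ≡ g y
  ∑-δ {zero}  []          g = trans (ℕ.+-identityʳ _) (ℕ.+-identityʳ _)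
  ∑-δ {suc d} (false ∷ y) g = trans (∑ℕ.∑-points d _) (trans (cong₂ _+_ (∑-δ y (λ x → g (false ∷ x))) (∑ℕ.∑-zero (points d))) (ℕ.+-identityʳ _))
  ∑-δ {suc d} (true ∷ y)  g = trans (∑ℕ.∑-points d _) (cong₂ _+_ (∑ℕ.∑-zero (points d)) (∑-δ y (λ x → g (true ∷ x))))

  ∑-δ-1 : ∀ {d} (y : Cube d) → ∑ (points d) (δ y) ≡ 1
  ∑-δ-1 {d} y = trans (∑ℕ.∑-cong (points d) (λ x → sym (ℕ.*-identityʳ (δ y x)))) (∑-δ y (λ _ → 1))

  δ-sym : ∀ {d} (x y : Cube d) → δ x y ≡ δ y x
  δ-sym []          []          = refl
  δ-sym (false ∷ x) (false ∷ y) = δ-sym x y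
  δ-sym (false ∷ x) (true ∷ y)  = refl
  δ-sym (true ∷ x)  (false ∷ y) = refl
  δ-sym (true ∷ x)  (true ∷ y)  = δ-sym x y

  δ-⊕ : ∀ {d} (x y z : Cube d) → δ (x ⊕ y) (x ⊕ z) ≡ δ y z
  δ-⊕ []          []          []          = refl
  δ-⊕ (false ∷ x) (false ∷ y) (false ∷ z) = δ-⊕ x y z
  δ-⊕ (false ∷ x) (false ∷ y) (true ∷ z)  = refl
  δ-⊕ (false ∷ x) (true ∷ y)  (false ∷ z) = refl
  δ-⊕ (false ∷ x) (true ∷ y)  (true ∷ z)  = δ-⊕ x y z
  δ-⊕ (true ∷ x)  (false ∷ y) (false ∷ z) = δ-⊕ x y z
  δ-⊕ (true ∷ x)  (false ∷ y) (true ∷ z)  = refl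
  δ-⊕ (true ∷ x)  (true ∷ y)  (false ∷ z) = refl
  δ-⊕ (true ∷ x)  (true ∷ y)  (true ∷ z)  = δ-⊕ x y z

  ∑-δ-⊕ : ∀ {d} (w v : Cube d) → ∑ (points d) (λ x → δ w (x ⊕ v)) ≡ 1
  ∑-δ-⊕ {d} w v = begin
    ∑ (points d) (λ x → δ w (x ⊕ v))  ≡⟨ ∑ℕ.∑-cong (points d) (λ x → cong (δ w) (⊕-comm x v)) ⟩
    ∑ (points d) (λ x → δ w (v ⊕ x))  ≡⟨ ∑ℕ.∑-translate d v (δ w) ⟩
    ∑ (points d) (δ w)                ≡⟨ ∑-δ-1 w ⟩
    1                                 ∎
    where
    open ≡-Reasoning
    ⊕-comm : ∀ {d} (x y : Cube d) → x ⊕ y ≡ y ⊕ x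
    ⊕-comm []      []      = refl
    ⊕-comm (a ∷ x) (b ∷ y) = cong₂ _∷_ (Bool.xor-comm a b) (⊕-comm x y)

  missing-erase : ∀ {d} xs (O : Oracle d) x → missing (erase xs O x) ≤ ∑ xs (δ x) + missing (O x)
  missing-erase xs O x = ℕ.≤-trans (split (does (x ∈? xs)) (O x)) (ℕ.+-monoˡ-≤ (missing (O x)) (member xs))
    where
    open DecMembership _≟_ using (_∈?_)
    split : ∀ b a → missing (if b then nothing else a) ≤ ⟦ b ⟧ + missing a
    split true  a = s≤s z≤n
    split false a = ℕ.≤-refl
    ∨≤+ : ∀ a b → ⟦ a ∨ b ⟧ ≤ ⟦ a ⟧ + ⟦ b ⟧
    ∨≤+ false b = ℕ.≤-refl
    ∨≤+ true  b = s≤s z≤n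
    member : ∀ xs → ⟦ does (x ∈? xs) ⟧ ≤ ∑ xs (δ x)
    member []       = z≤n
    member (y ∷ xs) = ℕ.≤-trans (∨≤+ (does (x ≟ y)) _) (ℕ.+-monoʳ-≤ (δ x y) (member xs))

  erased-erase : ∀ {d} xs {h h′} (O : Oracle d) → erased (h , erase xs O) ≤ length xs + erased (h′ , O)
  erased-erase {d} xs O = begin
    ∑ (points d) (λ x → missing (erase xs O x))                            ≤⟨ ∑-mono-≤ (points d) (missing-erase xs O) ⟩
    ∑ (points d) (λ x → ∑ xs (δ x) + missing (O x))                        ≡⟨ ∑ℕ.∑-+ (points d) _ _ ⟩
    ∑ (points d) (λ x → ∑ xs (λ y → δ x y)) + ∑ (points d) (λ x → missing (O x))
      ≡⟨ cong (_+ ∑ (points d) (λ x → missing (O x))) count ⟩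
    length xs + ∑ (points d) (λ x → missing (O x))                         ∎
    where
    open ℕ.≤-Reasoning
    count : ∑ (points d) (λ x → ∑ xs (λ y → δ x y)) ≡ length xs
    count = trans (∑ℕ.∑-swap (points d) xs δ)
      (trans (∑ℕ.∑-cong xs (λ y → trans (∑ℕ.∑-cong (points d) (λ x → δ-sym x y)) (∑-δ-1 y)))
             (trans (∑-const xs 1) (ℕ.*-identityʳ _)))

  erased-step : ∀ {t d} (σ : Strategy t d) s x → erased (step σ s x) ≤ t + erased s
  erased-step {t} σ (h , O) x = ℕ.≤-trans (erased-erase (Vec≤.toList (σ h′)) {h′} {h} O) (ℕ.+-monoˡ-≤ _ (length-toList (σ h′)))
    where
    h′ = (x , O x) ∷ h
    length-toList : ∀ {A : Set} (v : Vec≤ A t) → length (Vec≤.toList v) ≤ t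
    length-toList v = subst (_≤ t) (sym (Vec.length-toList (Vec≤.vec v))) (Vec≤.isBounded v)

  erased-steps : ∀ {t d} (σ : Strategy t d) s xs → erased (foldl (step σ) s xs) ≤ length xs * t + erased s
  erased-steps {t} σ s []       = ℕ.≤-refl
  erased-steps {t} σ s (x ∷ xs) = begin
    erased (foldl (step σ) (step σ s x) xs)   ≤⟨ erased-steps σ (step σ s x) xs ⟩
    length xs * t + erased (step σ s x)       ≤⟨ ℕ.+-monoʳ-≤ (length xs * t) (erased-step σ s x) ⟩
    length xs * t + (t + erased s)            ≡⟨ ℕ.+-assoc (length xs * t) t _ ⟨
    length xs * t + t + erased s              ≡⟨ cong (_+ erased s) (ℕ.+-comm (length xs * t) t) ⟩
    suc (length xs) * t + erased s            ∎
    where open ℕ.≤-Reasoning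

  -- Pairs of points and the selections made from them

  Pairs : ℕ → ℕ → Set
  Pairs d k = Vec (Cube d × Cube d) k

  pairs : ∀ d k → List (Pairs d k)
  pairs d = vectors (cartesianProduct (points d) (points d))

  flatten : ∀ {d k} → Pairs d k → List (Cube d)
  flatten []            = []
  flatten ((x , y) ∷ r) = x ∷ y ∷ flatten r

  pick : ∀ {A : Set} → Bool → A → A → A
  pick c x y = if c then x else y

  select : ∀ {d k} → Cube k → Pairs d k → Vec (Cube d) k
  select []       []            = []
  select (c ∷ cs) ((x , y) ∷ r) = pick c x y ∷ select cs r

  length-flatten : ∀ {d k} (r : Pairs d k) → length (flatten r) ≡ 2 * k
  length-flatten []                  = refl
  length-flatten {k = suc k} (_ ∷ r) = trans (cong (λ l → suc (suc l)) (length-flatten r)) (double k)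
    where
    double : ∀ k → suc (suc (2 * k)) ≡ 2 * suc k
    double = solve-∀

  ∑-pairs : ∀ d k (F : Pairs d (suc k) → ℕ) →
            ∑ (pairs d (suc k)) F ≡ ∑ (points d) (λ x → ∑ (points d) (λ y → ∑ (pairs d k) (λ r → F ((x , y) ∷ r))))
  ∑-pairs d k F = trans (∑-cartesian _∷_ (cartesianProduct (points d) (points d)) (pairs d k) F)
                        (∑-cartesian _,_ (points d) (points d) _)

  length-cartesianProduct : ∀ {A B : Set} (xs : List A) (ys : List B) → length (cartesianProduct xs ys) ≡ length xs * length ys
  length-cartesianProduct xs ys = begin
    length (cartesianProduct xs ys)           ≡⟨ ∑-1 (cartesianProduct xs ys) ⟨
    ∑ (cartesianProduct xs ys) (λ _ → 1)      ≡⟨ ∑-cartesian _,_ xs ys _ ⟩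
    ∑ xs (λ _ → ∑ ys (λ _ → 1))               ≡⟨ ∑-const xs _ ⟩
    length xs * ∑ ys (λ _ → 1)                ≡⟨ cong (length xs *_) (∑-1 ys) ⟩
    length xs * length ys                     ∎
    where open ≡-Reasoning

  ∑-pairs-const : ∀ d k c → ∑ (pairs d k) (λ _ → c) ≡ (2 ℕ.^ d * 2 ℕ.^ d) ℕ.^ k * c
  ∑-pairs-const d k c = trans (∑-vectors-const _ k c) (cong (λ l → l ℕ.^ k * c)
    (trans (length-cartesianProduct (points d) (points d)) (cong₂ _*_ (length-points d) (length-points d))))

  -- For fixed bits the point of each pair that is not selected is free and contributes a factor
  -- `2 ^ d`. Hence the selected points are uniform and independent for every choice of bits.
  ∑-select : ∀ {d k} (c : Cube k) (g : Vec (Cube d) k → ℕ) →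
             ∑ (pairs d k) (λ r → g (select c r)) ≡ (2 ℕ.^ d) ℕ.^ k * ∑ (vectors (points d) k) g
  ∑-select []              g = sym (ℕ.+-identityʳ _)
  ∑-select {d} {suc k} (c ∷ cs) g = begin
    ∑ (pairs d (suc k)) (λ r → g (select (c ∷ cs) r))
      ≡⟨ ∑-pairs d k _ ⟩
    ∑ (points d) (λ x → ∑ (points d) (λ y → ∑ (pairs d k) (λ r → g (pick c x y ∷ select cs r))))
      ≡⟨ ∑-cong (points d) (λ x → ∑-cong (points d) (λ y → ∑-select cs (λ zs → g (pick c x y ∷ zs)))) ⟩
    ∑ (points d) (λ x → ∑ (points d) (λ y → h (pick c x y)))
      ≡⟨ choose c ⟩
    2 ℕ.^ d * ∑ (points d) h
      ≡⟨ cong (2 ℕ.^ d *_) (∑-*ˡ (points d) ((2 ℕ.^ d) ℕ.^ k) _) ⟩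
    2 ℕ.^ d * ((2 ℕ.^ d) ℕ.^ k * ∑ (points d) (λ z → ∑ (vectors (points d) k) (λ zs → g (z ∷ zs))))
      ≡⟨ ℕ.*-assoc (2 ℕ.^ d) _ _ ⟨
    (2 ℕ.^ d) ℕ.^ suc k * ∑ (points d) (λ z → ∑ (vectors (points d) k) (λ zs → g (z ∷ zs)))
      ≡⟨ cong ((2 ℕ.^ d) ℕ.^ suc k *_) (∑-cartesian _∷_ (points d) (vectors (points d) k) g) ⟨
    (2 ℕ.^ d) ℕ.^ suc k * ∑ (vectors (points d) (suc k)) g ∎
    where
    open ≡-Reasoning
    h : Cube d → ℕ
    h z = (2 ℕ.^ d) ℕ.^ k * ∑ (vectors (points d) k) (λ zs → g (z ∷ zs))
    choose : ∀ c → ∑ (points d) (λ x → ∑ (points d) (λ y → h (pick c x y))) ≡ 2 ℕ.^ d * ∑ (points d) h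
    choose true  = trans (∑-cong (points d) (λ x → ∑-points-const d (h x))) (∑-*ˡ (points d) (2 ℕ.^ d) h)
    choose false = ∑-points-const d _

  -- Collisions among the sums of selections

  distinct : ∀ {k} → Cube k → Cube k → ℕ
  distinct c c′ = ⟦ not (does (c ≟ c′)) ⟧

  -- Where the bits agree, the same point enters both sums and cancels. At the first pair where they
  -- differ, one sum contains `x` and the other `y`, so for given `x` and given later pairs exactly
  -- one `y` makes the sums equal. The factor `distinct` makes equal selections count zero.
  collision-bound : ∀ {d k} (c c′ : Cube k) →
    2 ℕ.^ d * ∑ (pairs d k) (λ r → distinct c c′ * δ (total (select c r)) (total (select c′ r))) ≤ (2 ℕ.^ d * 2 ℕ.^ d) ℕ.^ k
  collision-bound {d} [] [] = subst (_≤ 1) (sym (ℕ.*-zeroʳ (2 ℕ.^ d))) z≤n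
  collision-bound {d} {suc k} (b ∷ c) (b′ ∷ c′) = subst (_≤ (D * D) ℕ.^ suc k) (cong (D *_) (sym (∑-pairs d k _))) (go b b′)
    where
    open ℕ.≤-Reasoning
    D = 2 ℕ.^ d
    L = (D * D) ℕ.^ k
    u v : Pairs d k → Cube d
    u r = total (select c r)
    v r = total (select c′ r)

    same : ∀ (w : Cube d → Cube d → Cube d) →
      D * ∑ (points d) (λ x → ∑ (points d) (λ y → ∑ (pairs d k) (λ r → distinct c c′ * δ (w x y ⊕ u r) (w x y ⊕ v r)))) ≤ D * D * L
    same w = begin
      D * ∑ (points d) (λ x → ∑ (points d) (λ y → ∑ (pairs d k) (λ r → distinct c c′ * δ (w x y ⊕ u r) (w x y ⊕ v r))))
        ≡⟨ cong (D *_) (∑-cong (points d) (λ x → ∑-cong (points d) (λ y → ∑-cong (pairs d k) (λ r → cong (distinct c c′ *_) (δ-⊕ (w x y) (u r) (v r)))))) ⟩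
      D * ∑ (points d) (λ x → ∑ (points d) (λ y → X))
        ≡⟨ cong (D *_) (trans (∑-cong (points d) (λ x → ∑-points-const d X)) (∑-points-const d (D * X))) ⟩
      D * (D * (D * X))
        ≤⟨ ℕ.*-monoʳ-≤ D (ℕ.*-monoʳ-≤ D (collision-bound {d} c c′)) ⟩
      D * (D * L)
        ≡⟨ ℕ.*-assoc D D L ⟨
      D * D * L ∎
      where X = ∑ (pairs d k) (λ r → distinct c c′ * δ (u r) (v r))

    different : ∀ (e : Cube d → Cube d → Pairs d k → ℕ) → (∀ x r → ∑ (points d) (λ y → e x y r) ≡ 1) →
      D * ∑ (points d) (λ x → ∑ (points d) (λ y → ∑ (pairs d k) (λ r → 1 * e x y r))) ≤ D * D * L
    different e e-sum = ℕ.≤-reflexive (begin-equality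
      D * ∑ (points d) (λ x → ∑ (points d) (λ y → ∑ (pairs d k) (λ r → 1 * e x y r)))
        ≡⟨ cong (D *_) (∑-cong (points d) (λ x → trans (∑-swap (points d) (pairs d k) _)
             (∑-cong (pairs d k) (λ r → trans (∑-cong (points d) (λ y → ℕ.*-identityˡ _)) (e-sum x r))))) ⟩
      D * ∑ (points d) (λ x → ∑ (pairs d k) (λ r → 1))
        ≡⟨ cong (D *_) (trans (∑-points-const d _) (cong (D *_) (trans (∑-pairs-const d k 1) (ℕ.*-identityʳ L)))) ⟩
      D * (D * L)
        ≡⟨ ℕ.*-assoc D D L ⟨
      D * D * L ∎)

    go : ∀ b b′ → D * ∑ (points d) (λ x → ∑ (points d) (λ y → ∑ (pairs d k) (λ r →
           distinct (b ∷ c) (b′ ∷ c′) * δ (pick b x y ⊕ u r) (pick b′ x y ⊕ v r)))) ≤ D * D * L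
    go false false = same (λ x y → y)
    go true  true  = same (λ x y → x)
    go true  false = different _ (λ x r → ∑-δ-⊕ (x ⊕ u r) (v r))
    go false true  = different _ (λ x r → trans (∑-cong (points d) (λ y → δ-sym (y ⊕ u r) (x ⊕ v r))) (∑-δ-⊕ (x ⊕ v r) (u r)))

  collisions : ∀ {d k} → (Cube k → Cube d) → ℕ
  collisions {d} {k} z = ∑ (points k) (λ c → ∑ (points k) (λ c′ → distinct c c′ * δ (z c) (z c′)))

  m≤1+off : ∀ m off → m * m ≡ m + off → m ≤ 1 + off
  m≤1+off zero          off eq = z≤n
  m≤1+off (suc zero)    off eq = s≤s z≤n
  m≤1+off (suc (suc m)) off eq = ℕ.m≤n⇒m≤1+n (ℕ.≤-trans (ℕ.m≤m+n (suc (suc m)) (m * suc (suc m)))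
    (ℕ.≤-reflexive (ℕ.+-cancelˡ-≡ (suc (suc m)) _ _ eq)))

  -- A fibre of size m contains m (m - 1) ≥ m - 1 ordered pairs of distinct elements.
  fibre-bound : ∀ {k} (p : Cube k → ℕ) → (∀ c → p c * p c ≡ p c) →
    ∑ (points k) p ≤ 1 + ∑ (points k) (λ c → ∑ (points k) (λ c′ → distinct c c′ * (p c * p c′)))
  fibre-bound {k} p idem = m≤1+off _ _ (begin
    ∑ (points k) p * ∑ (points k) p
      ≡⟨ ∑-*ʳ (points k) (∑ (points k) p) p ⟨
    ∑ (points k) (λ c → p c * ∑ (points k) p)
      ≡⟨ ∑-cong (points k) split ⟩
    ∑ (points k) (λ c → p c + ∑ (points k) (λ c′ → distinct c c′ * (p c * p c′)))
      ≡⟨ ∑-+ (points k) _ _ ⟩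
    ∑ (points k) p + ∑ (points k) (λ c → ∑ (points k) (λ c′ → distinct c c′ * (p c * p c′))) ∎)
    where
    open ≡-Reasoning
    cases : ∀ b e → e ≡ ⟦ b ⟧ * e + ⟦ not b ⟧ * e
    cases false e = sym (ℕ.+-identityʳ e)
    cases true  e = trans (sym (ℕ.+-identityʳ e)) (sym (ℕ.+-identityʳ (e + 0)))
    split : ∀ c → p c * ∑ (points k) p ≡ p c + ∑ (points k) (λ c′ → distinct c c′ * (p c * p c′))
    split c = begin
      p c * ∑ (points k) p
        ≡⟨ ∑-*ˡ (points k) (p c) p ⟨
      ∑ (points k) (λ c′ → p c * p c′)
        ≡⟨ ∑-cong (points k) (λ c′ → cases (does (c ≟ c′)) (p c * p c′)) ⟩
      ∑ (points k) (λ c′ → δ c c′ * (p c * p c′) + distinct c c′ * (p c * p c′))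
        ≡⟨ ∑-+ (points k) _ _ ⟩
      ∑ (points k) (λ c′ → δ c c′ * (p c * p c′)) + ∑ (points k) (λ c′ → distinct c c′ * (p c * p c′))
        ≡⟨ cong (_+ ∑ (points k) (λ c′ → distinct c c′ * (p c * p c′))) (trans (∑-δ c (λ c′ → p c * p c′)) (idem c)) ⟩
      p c + ∑ (points k) (λ c′ → distinct c c′ * (p c * p c′)) ∎

  missing≤1 : ∀ a → missing a ≤ 1
  missing≤1 nothing  = ℕ.≤-refl
  missing≤1 (just _) = z≤n

  -- The selections are grouped by the point `z c` they lead to. An erased point spoils its whole
  -- fibre, and by `fibre-bound` a fibre has at most one element more than it has colliding ordered
  -- pairs. Up to collisions, one erasure spoils one selection.
  last-query-bound : ∀ {d k} (s : State d) (z : Cube k → Cube d) →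
    ∑ (points k) (λ c → missing (proj₂ s (z c))) ≤ erased s + collisions z
  last-query-bound {d} {k} s@(_ , O) z = begin
    ∑ (points k) (λ c → missing (O (z c)))
      ≡⟨ ∑-cong (points k) (λ c → ∑-δ (z c) (λ x → missing (O x))) ⟨
    ∑ (points k) (λ c → ∑ (points d) (λ x → δ (z c) x * missing (O x)))
      ≡⟨ ∑-swap (points k) (points d) _ ⟩
    ∑ (points d) (λ x → ∑ (points k) (λ c → δ (z c) x * missing (O x)))
      ≤⟨ ∑-mono-≤ (points d) fibre ⟩
    ∑ (points d) (λ x → missing (O x) + off x)
      ≡⟨ ∑-+ (points d) _ _ ⟩
    erased s + ∑ (points d) off
      ≡⟨ cong (erased s +_) off-sum ⟩
    erased s + collisions z ∎
    where
    open ℕ.≤-Reasoning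
    off : Cube d → ℕ
    off x = ∑ (points k) (λ c → ∑ (points k) (λ c′ → distinct c c′ * (δ (z c) x * δ (z c′) x)))

    idem : ∀ b → ⟦ b ⟧ * ⟦ b ⟧ ≡ ⟦ b ⟧
    idem false = refl
    idem true  = refl

    fibre : ∀ x → ∑ (points k) (λ c → δ (z c) x * missing (O x)) ≤ missing (O x) + off x
    fibre x = begin
      ∑ (points k) (λ c → δ (z c) x * missing (O x))  ≡⟨ ∑-*ʳ (points k) (missing (O x)) _ ⟩
      ∑ (points k) (λ c → δ (z c) x) * missing (O x)  ≤⟨ ℕ.*-monoˡ-≤ (missing (O x)) (fibre-bound (λ c → δ (z c) x) (λ c → idem (does (z c ≟ x)))) ⟩
      (1 + off x) * missing (O x)                     ≡⟨ cong (missing (O x) +_) (ℕ.*-comm (off x) _) ⟩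
      missing (O x) + missing (O x) * off x           ≤⟨ ℕ.+-monoʳ-≤ (missing (O x)) (ℕ.*-monoˡ-≤ (off x) (missing≤1 (O x))) ⟩
      missing (O x) + 1 * off x                       ≡⟨ cong (missing (O x) +_) (ℕ.*-identityˡ (off x)) ⟩
      missing (O x) + off x                           ∎

    left-commute : ∀ u v w → u * (v * w) ≡ v * (u * w)
    left-commute = solve-∀

    off-sum : ∑ (points d) off ≡ collisions z
    off-sum = begin-equality
      ∑ (points d) off
        ≡⟨ ∑-swap (points d) (points k) _ ⟩
      ∑ (points k) (λ c → ∑ (points d) (λ x → ∑ (points k) (λ c′ → distinct c c′ * (δ (z c) x * δ (z c′) x))))
        ≡⟨ ∑-cong (points k) (λ c → ∑-swap (points d) (points k) _) ⟩
      ∑ (points k) (λ c → ∑ (points k) (λ c′ → ∑ (points d) (λ x → distinct c c′ * (δ (z c) x * δ (z c′) x))))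
        ≡⟨ ∑-cong (points k) (λ c → ∑-cong (points k) (λ c′ → trans (∑-*ˡ (points d) (distinct c c′) _)
             (cong (distinct c c′ *_) (trans (∑-δ (z c) (δ (z c′))) (δ-sym (z c′) (z c)))))) ⟩
      collisions z ∎

  -- Erased answers among the uniform queries

  module _ {t d : ℕ} (σ : Strategy t d) where
    private D = 2 ℕ.^ d

    -- Each of the `2 * k` queries is uniform given the past, so it is erased with probability at
    -- most `M / D`, whatever the strategy did before. `M` includes the erasures still to come, so
    -- that the same `M` serves every later state of the induction.
    pairs-hits : ∀ k s {M} → 2 * k * t + erased s ≤ M →
      D * ∑ (pairs d k) (λ r → hits σ s (flatten r)) ≤ (D * D) ℕ.^ k * (2 * k * M)
    pairs-hits zero    s {M} bound = ℕ.≤-reflexive (ℕ.*-zeroʳ D)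
    pairs-hits (suc k) s {M} bound = begin
      D * ∑ (pairs d (suc k)) (λ r → hits σ s (flatten r))
        ≡⟨ cong (D *_) (∑-pairs d k _) ⟩
      D * ∑ (points d) (λ x → ∑ (points d) (λ y → ∑ (pairs d k) (λ r → miss x + (miss′ x y + hits σ (s′ x y) (flatten r)))))
        ≡⟨ ∑-*ˡ (points d) D _ ⟨
      ∑ (points d) (λ x → D * ∑ (points d) (λ y → ∑ (pairs d k) (λ r → miss x + (miss′ x y + hits σ (s′ x y) (flatten r)))))
        ≤⟨ ∑-mono-≤ (points d) after-first ⟩
      ∑ (points d) (λ x → D * L * (D * miss x) + (D * L * M + D * (L * (2 * k * M))))
        ≡⟨ ∑-+ (points d) _ _ ⟩
      ∑ (points d) (λ x → D * L * (D * miss x)) + ∑ (points d) (λ _ → D * L * M + D * (L * (2 * k * M)))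
        ≡⟨ cong₂ _+_ (trans (∑-*ˡ (points d) (D * L) _) (cong (D * L *_) (∑-*ˡ (points d) D miss))) (∑-points-const d _) ⟩
      D * L * (D * erased s) + D * (D * L * M + D * (L * (2 * k * M)))
        ≤⟨ ℕ.+-monoˡ-≤ _ (ℕ.*-monoʳ-≤ (D * L) (ℕ.*-monoʳ-≤ D (ℕ.≤-trans (ℕ.m≤n+m _ (2 * suc k * t)) bound))) ⟩
      D * L * (D * M) + D * (D * L * M + D * (L * (2 * k * M)))
        ≡⟨ collect D L k M ⟩
      (D * D) * L * (2 * suc k * M) ∎
      where
      open ℕ.≤-Reasoning
      L = (D * D) ℕ.^ k
      miss : Cube d → ℕ
      miss x = missing (proj₂ s x)
      miss′ : Cube d → Cube d → ℕ
      miss′ x y = missing (proj₂ (step σ s x) y)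
      s′ : Cube d → Cube d → State d
      s′ x y = step σ (step σ s x) y

      collect : ∀ D L k M → D * L * (D * M) + D * (D * L * M + D * (L * (2 * k * M))) ≡ (D * D) * L * (2 * suc k * M)
      collect = solve-∀
      regroup : ∀ k t e → 2 * k * t + (t + (t + e)) ≡ 2 * suc k * t + e
      regroup = solve-∀

      bound₂ : ∀ x y → 2 * k * t + erased (s′ x y) ≤ M
      bound₂ x y = begin
        2 * k * t + erased (s′ x y)          ≤⟨ ℕ.+-monoʳ-≤ (2 * k * t) (ℕ.≤-trans (erased-step σ (step σ s x) y) (ℕ.+-monoʳ-≤ t (erased-step σ s x))) ⟩
        2 * k * t + (t + (t + erased s))     ≡⟨ regroup k t (erased s) ⟩
        2 * suc k * t + erased s             ≤⟨ bound ⟩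
        M                                    ∎

      bound₁ : ∀ x → erased (step σ s x) ≤ M
      bound₁ x = begin
        erased (step σ s x)                  ≤⟨ erased-step σ s x ⟩
        t + erased s                         ≤⟨ ℕ.m≤n+m _ (2 * k * t + t) ⟩
        2 * k * t + t + (t + erased s)       ≡⟨ ℕ.+-assoc (2 * k * t) t _ ⟩
        2 * k * t + (t + (t + erased s))     ≡⟨ regroup k t (erased s) ⟩
        2 * suc k * t + erased s             ≤⟨ bound ⟩
        M                                    ∎

      distribute : ∀ D L a b X → D * (L * a + (L * b + X)) ≡ D * L * a + (D * L * b + D * X)
      distribute = solve-∀

      after-second : ∀ x y → D * ∑ (pairs d k) (λ r → miss x + (miss′ x y + hits σ (s′ x y) (flatten r))) ≤
                             D * L * miss x + (D * L * miss′ x y + L * (2 * k * M))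
      after-second x y = begin
        D * ∑ (pairs d k) (λ r → miss x + (miss′ x y + hits σ (s′ x y) (flatten r)))
          ≡⟨ cong (D *_) (trans (∑-+ (pairs d k) _ _) (cong₂ _+_ (∑-pairs-const d k (miss x))
               (trans (∑-+ (pairs d k) _ _) (cong (_+ X) (∑-pairs-const d k (miss′ x y)))))) ⟩
        D * (L * miss x + (L * miss′ x y + X))
          ≡⟨ distribute D L (miss x) (miss′ x y) X ⟩
        D * L * miss x + (D * L * miss′ x y + D * X)
          ≤⟨ ℕ.+-monoʳ-≤ (D * L * miss x) (ℕ.+-monoʳ-≤ (D * L * miss′ x y) (pairs-hits k (s′ x y) (bound₂ x y))) ⟩
        D * L * miss x + (D * L * miss′ x y + L * (2 * k * M)) ∎
        where X = ∑ (pairs d k) (λ r → hits σ (s′ x y) (flatten r))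

      after-first : ∀ x → D * ∑ (points d) (λ y → ∑ (pairs d k) (λ r → miss x + (miss′ x y + hits σ (s′ x y) (flatten r)))) ≤
                          D * L * (D * miss x) + (D * L * M + D * (L * (2 * k * M)))
      after-first x = begin
        D * ∑ (points d) (λ y → ∑ (pairs d k) (λ r → miss x + (miss′ x y + hits σ (s′ x y) (flatten r))))
          ≡⟨ ∑-*ˡ (points d) D _ ⟨
        ∑ (points d) (λ y → D * ∑ (pairs d k) (λ r → miss x + (miss′ x y + hits σ (s′ x y) (flatten r))))
          ≤⟨ ∑-mono-≤ (points d) (after-second x) ⟩
        ∑ (points d) (λ y → D * L * miss x + (D * L * miss′ x y + L * (2 * k * M)))
          ≡⟨ trans (∑-+ (points d) _ _) (cong₂ _+_ (∑-points-const d _) (trans (∑-+ (points d) _ _)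
               (cong₂ _+_ (∑-*ˡ (points d) (D * L) _) (∑-points-const d _)))) ⟩
        D * (D * L * miss x) + (D * L * erased (step σ s x) + D * (L * (2 * k * M)))
          ≡⟨ cong (_+ (D * L * erased (step σ s x) + D * (L * (2 * k * M)))) (commute D L (miss x)) ⟩
        D * L * (D * miss x) + (D * L * erased (step σ s x) + D * (L * (2 * k * M)))
          ≤⟨ ℕ.+-monoʳ-≤ (D * L * (D * miss x)) (ℕ.+-monoˡ-≤ _ (ℕ.*-monoʳ-≤ (D * L) (bound₁ x))) ⟩
        D * L * (D * miss x) + (D * L * M + D * (L * (2 * k * M))) ∎
        where
        commute : ∀ D L m → D * (D * L * m) ≡ D * L * (D * m)
        commute = solve-∀

  -- The tester and the list of its queries

  Seed : ℕ → ℕ → Set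
  Seed d k = Pairs d k × Cube k

  seeds : ∀ d k → List (Seed d k)
  seeds d k = cartesianProduct (pairs d k) (points k)

  -- The secret bits enter only the last query; everything before it is the same for all of them.
  asked : ∀ {d k} → Seed d k → List (Cube d)
  asked (r , c) = flatten r ++ total (select c r) ∷ []

  questions : ∀ {d k N} → Vec (Seed d k) N → List (Cube d)
  questions []      = []
  questions (s ∷ ω) = asked s ++ questions ω

  -- A check with an erased value is no evidence against linearity; counting it as passed keeps the
  -- error one-sided.
  agree : Answer → Answer → Bool
  agree (just u) (just v) = not (u xor v)
  agree _        _        = true

  -- Both points of a pair are queried whichever is selected, so these queries reveal nothing about
  -- the bits. The answer to the other point is discarded, and an erased selected answer erases the
  -- whole sum.
  gather : ∀ {d k} → Pairs d k → Cube k → (Answer → Algorithm d) → Algorithm d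
  gather []            []       K = K (just false)
  gather ((x , y) ∷ r) (c ∷ cs) K =
    query x λ a → query y λ b → gather r cs λ p → K (zipWith _xor_ (pick c a b) p)

  -- A failed check is only recorded in `ok` and the queries go on, so that their list does not
  -- depend on the answers.
  verify : ∀ {d k N} → Vec (Seed d k) N → Bool → Algorithm d
  verify []            ok = output ok
  verify ((r , c) ∷ ω) ok = gather r c λ p → query (total (select c r)) λ a → verify ω (ok ∧ agree p a)

  length-asked : ∀ {d k} (s : Seed d k) → length (asked s) ≡ suc (2 * k)
  length-asked {k = k} (r , c) = trans (List.length-++ (flatten r)) (trans (cong (_+ 1) (length-flatten r)) (ℕ.+-comm (2 * k) 1))

  length-questions : ∀ {d k N} (ω : Vec (Seed d k) N) → length (questions ω) ≡ N * suc (2 * k)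
  length-questions []      = refl
  length-questions (s ∷ ω) = trans (List.length-++ (asked s)) (cong₂ _+_ (length-asked s) (length-questions ω))

  gather-asks : ∀ {d k} (r : Pairs d k) c {K xs} → (∀ p → Asks (K p) xs) → Asks (gather r c K) (flatten r ++ xs)
  gather-asks []            []       asks = asks _
  gather-asks ((x , y) ∷ r) (c ∷ cs) asks = query λ a → query λ b → gather-asks r cs λ p → asks _

  verify-asks : ∀ {d k N} (ω : Vec (Seed d k) N) ok → Asks (verify ω ok) (questions ω)
  verify-asks []            ok = output
  verify-asks ((r , c) ∷ ω) ok =
    subst (Asks _) (sym (List.++-assoc (flatten r) (total (select c r) ∷ []) (questions ω)))
      (gather-asks r c λ p → query λ a → verify-asks ω _)

  asks⇒queryBound : ∀ {d} {alg : Algorithm d} {xs} → Asks alg xs → QueryBound (length xs) alg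
  asks⇒queryBound output       = output
  asks⇒queryBound (query asks) = query λ a → asks⇒queryBound (asks a)

  -- Executions without erasures

  all-pass : ∀ {d k N} → BoolFun d → Vec (Seed d k) N → Bool
  all-pass f []            = true
  all-pass f ((r , c) ∷ ω) = passes f (select c r) ∧ all-pass f ω

  run-gather : ∀ {d k} (f : BoolFun d) (r : Pairs d k) c K →
               run f (gather r c K) ≡ run f (K (just (values f (select c r))))
  run-gather f []            []           K = refl
  run-gather f ((x , y) ∷ r) (true ∷ cs)  K = run-gather f r cs _
  run-gather f ((x , y) ∷ r) (false ∷ cs) K = run-gather f r cs _

  run-verify : ∀ {d k N} (f : BoolFun d) (ω : Vec (Seed d k) N) ok → run f (verify ω ok) ≡ ok ∧ all-pass f ω
  run-verify f []            ok = sym (Bool.∧-identityʳ ok)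
  run-verify f ((r , c) ∷ ω) ok = trans (run-gather f r c _)
    (trans (run-verify f ω _) (Bool.∧-assoc ok (passes f (select c r)) _))

  -- Without erasures the iterations are independent, so the count factors.
  ∑-all-pass : ∀ {d k} (f : BoolFun d) N →
    ∑ (vectors (seeds d k) N) (λ ω → ⟦ all-pass f ω ⟧) ≡ ∑ (seeds d k) (λ (r , c) → ⟦ passes f (select c r) ⟧) ℕ.^ N
  ∑-all-pass f zero = refl
  ∑-all-pass {d} {k} f (suc N) = begin
    ∑ (vectors (seeds d k) (suc N)) (λ ω → ⟦ all-pass f ω ⟧)
      ≡⟨ ∑-cartesian _∷_ (seeds d k) (vectors (seeds d k) N) _ ⟩
    ∑ (seeds d k) (λ s → ∑ (vectors (seeds d k) N) (λ ω → ⟦ pass s ∧ all-pass f ω ⟧))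
      ≡⟨ ∑-cong (seeds d k) (λ s → trans (∑-cong (vectors (seeds d k) N) (λ ω → ⟦∧⟧ (pass s) (all-pass f ω))) (∑-*ˡ (vectors (seeds d k) N) ⟦ pass s ⟧ _)) ⟩
    ∑ (seeds d k) (λ s → ⟦ pass s ⟧ * ∑ (vectors (seeds d k) N) (λ ω → ⟦ all-pass f ω ⟧))
      ≡⟨ ∑-*ʳ (seeds d k) _ _ ⟩
    ∑ (seeds d k) (λ s → ⟦ pass s ⟧) * ∑ (vectors (seeds d k) N) (λ ω → ⟦ all-pass f ω ⟧)
      ≡⟨ cong (∑ (seeds d k) (λ s → ⟦ pass s ⟧) *_) (∑-all-pass f N) ⟩
    ∑ (seeds d k) (λ s → ⟦ pass s ⟧) ℕ.^ suc N ∎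
    where
    open ≡-Reasoning
    pass : Seed d k → Bool
    pass (r , c) = passes f (select c r)
    ⟦∧⟧ : ∀ a b → ⟦ a ∧ b ⟧ ≡ ⟦ a ⟧ * ⟦ b ⟧
    ⟦∧⟧ false b = refl
    ⟦∧⟧ true  b = sym (ℕ.+-identityʳ ⟦ b ⟧)

  ∑-passes : ∀ {d k} (f : BoolFun d) →
    ∑ (seeds d k) (λ (r , c) → ⟦ passes f (select c r) ⟧) ≡
    2 ℕ.^ k * ((2 ℕ.^ d) ℕ.^ k * ∑ (vectors (points d) k) (λ zs → ⟦ passes f zs ⟧))
  ∑-passes {d} {k} f = begin
    ∑ (seeds d k) (λ (r , c) → ⟦ passes f (select c r) ⟧)
      ≡⟨ ∑-cartesian _,_ (pairs d k) (points k) _ ⟩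
    ∑ (pairs d k) (λ r → ∑ (points k) (λ c → ⟦ passes f (select c r) ⟧))
      ≡⟨ ∑-swap (pairs d k) (points k) _ ⟩
    ∑ (points k) (λ c → ∑ (pairs d k) (λ r → ⟦ passes f (select c r) ⟧))
      ≡⟨ ∑-cong (points k) (λ c → ∑-select c (λ zs → ⟦ passes f zs ⟧)) ⟩
    ∑ (points k) (λ c → (2 ℕ.^ d) ℕ.^ k * ∑ (vectors (points d) k) (λ zs → ⟦ passes f zs ⟧))
      ≡⟨ ∑-points-const k _ ⟩
    2 ℕ.^ k * ((2 ℕ.^ d) ℕ.^ k * ∑ (vectors (points d) k) (λ zs → ⟦ passes f zs ⟧)) ∎
    where open ≡-Reasoning

  length-seeds : ∀ d k → length (seeds d k) ≡ (2 ℕ.^ d * 2 ℕ.^ d) ℕ.^ k * 2 ℕ.^ k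
  length-seeds d k = trans (length-cartesianProduct (pairs d k) (points k)) (cong₂ _*_ length-pairs (length-points k))
    where
    length-pairs : length (pairs d k) ≡ (2 ℕ.^ d * 2 ℕ.^ d) ℕ.^ k
    length-pairs = trans (sym (∑-1 (pairs d k))) (trans (∑-pairs-const d k 1) (ℕ.*-identityʳ ((2 ℕ.^ d * 2 ℕ.^ d) ℕ.^ k)))

  -- One-sidedness

  -- Covers every sequence of answers that are correct or erased. No strategy can produce anything
  -- else, so one-sidedness can be proved from the algorithm alone.
  Accepting : ∀ {d} → BoolFun d → Algorithm d → Set
  Accepting f (output b)  = b ≡ true
  Accepting f (query x k) = ∀ a → a ≡ just (f x) ⊎ a ≡ nothing → Accepting f (k a)

  execute-accepting : ∀ {t d} (σ : Strategy t d) {f} alg h O → Accepting f alg → Truthful f O → execute σ h O alg ≡ true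
  execute-accepting σ (output b)  h O acc truthful = acc
  execute-accepting σ (query x k) h O acc truthful =
    execute-accepting σ (k (O x)) _ _ (acc (O x) (truthful x)) (erase-truthful (Vec≤.toList (σ ((x , O x) ∷ h))) truthful)

  gather-accepting : ∀ {d k} (f : BoolFun d) (r : Pairs d k) c {K} →
    (∀ p → p ≡ just (values f (select c r)) ⊎ p ≡ nothing → Accepting f (K p)) → Accepting f (gather r c K)
  gather-accepting f []            []       acc = acc _ (inj₁ refl)
  gather-accepting f ((x , y) ∷ r) (c ∷ cs) acc a a-ok b b-ok =
    gather-accepting f r cs λ p p-ok → acc _ (combine (chosen c a-ok b-ok) p-ok)
    where
    chosen : ∀ c {a b} → a ≡ just (f x) ⊎ a ≡ nothing → b ≡ just (f y) ⊎ b ≡ nothing →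
             pick c a b ≡ just (f (pick c x y)) ⊎ pick c a b ≡ nothing
    chosen true  a-ok b-ok = a-ok
    chosen false a-ok b-ok = b-ok
    combine : ∀ {a p u v} → a ≡ just u ⊎ a ≡ nothing → p ≡ just v ⊎ p ≡ nothing →
              zipWith _xor_ a p ≡ just (u xor v) ⊎ zipWith _xor_ a p ≡ nothing
    combine (inj₁ refl) (inj₁ refl) = inj₁ refl
    combine (inj₁ refl) (inj₂ refl) = inj₂ refl
    combine (inj₂ refl) _           = inj₂ refl

  values-linear : ∀ {d k} {f : BoolFun d} → Linear d f → (zs : Vec (Cube d) k) → values f zs ≡ f (total zs)
  values-linear (S , f≡S) []       = sym (trans (f≡S zeros) (parity-zeros S))
    where
    parity-zeros : ∀ {d} (S : Cube d) → parity S zeros ≡ false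
    parity-zeros []          = refl
    parity-zeros (false ∷ S) = parity-zeros S
    parity-zeros (true ∷ S)  = parity-zeros S
  values-linear {f = f} L@(S , f≡S) (z ∷ zs) = begin
    f z xor values f zs                 ≡⟨ cong (f z xor_) (values-linear L zs) ⟩
    f z xor f (total zs)                ≡⟨ cong₂ _xor_ (f≡S z) (f≡S (total zs)) ⟩
    parity S z xor parity S (total zs)  ≡⟨ parity-⊕ S z (total zs) ⟨
    parity S (z ⊕ total zs)             ≡⟨ f≡S (z ⊕ total zs) ⟨
    f (z ⊕ total zs)                    ∎
    where open ≡-Reasoning

  verify-accepting : ∀ {d k N} {f : BoolFun d} → Linear d f → (ω : Vec (Seed d k) N) → Accepting f (verify ω true)
  verify-accepting L []                    = refl
  verify-accepting {f = f} L ((r , c) ∷ ω) = gather-accepting f r c λ p p-ok a a-ok →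
    subst (λ ok → Accepting f (verify ω ok)) (sym (consistent p-ok a-ok)) (verify-accepting L ω)
    where
    consistent : ∀ {p a} → p ≡ just (values f (select c r)) ⊎ p ≡ nothing →
                 a ≡ just (f (total (select c r))) ⊎ a ≡ nothing → agree p a ≡ true
    consistent (inj₁ refl) (inj₁ refl) = cong not (trans (cong (_xor f (total (select c r))) (values-linear L (select c r))) (Bool.xor-same (f (total (select c r)))))
    consistent (inj₁ refl) (inj₂ refl) = refl
    consistent (inj₂ refl) _           = refl

  -- Expected number of erased answers

  ∑-collisions : ∀ d k → 2 ℕ.^ d * ∑ (pairs d k) (λ r → collisions (λ c → total (select c r))) ≤
                         (2 ℕ.^ d * 2 ℕ.^ d) ℕ.^ k * (2 ℕ.^ k * 2 ℕ.^ k)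
  ∑-collisions d k = begin
    D * ∑ (pairs d k) (λ r → ∑ (points k) (λ c → ∑ (points k) (λ c′ → e r c c′)))
      ≡⟨ cong (D *_) (trans (∑-swap (pairs d k) (points k) _) (∑-cong (points k) (λ c → ∑-swap (pairs d k) (points k) _))) ⟩
    D * ∑ (points k) (λ c → ∑ (points k) (λ c′ → ∑ (pairs d k) (λ r → e r c c′)))
      ≡⟨ trans (∑-cong (points k) (λ c → ∑-*ˡ (points k) D _)) (∑-*ˡ (points k) D _) ⟨
    ∑ (points k) (λ c → ∑ (points k) (λ c′ → D * ∑ (pairs d k) (λ r → e r c c′)))
      ≤⟨ ∑-mono-≤ (points k) (λ c → ∑-mono-≤ (points k) (λ c′ → collision-bound {d} c c′)) ⟩
    ∑ (points k) (λ c → ∑ (points k) (λ c′ → L))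
      ≡⟨ trans (∑-points-const k _) (cong (2 ℕ.^ k *_) (∑-points-const k L)) ⟩
    2 ℕ.^ k * (2 ℕ.^ k * L)
      ≡⟨ rotate (2 ℕ.^ k) L ⟩
    L * (2 ℕ.^ k * 2 ℕ.^ k) ∎
    where
    open ℕ.≤-Reasoning
    D = 2 ℕ.^ d
    L = (D * D) ℕ.^ k
    e : Pairs d k → Cube k → Cube k → ℕ
    e r c c′ = distinct c c′ * δ (total (select c r)) (total (select c′ r))
    rotate : ∀ K L → K * (K * L) ≡ L * (K * K)
    rotate = solve-∀

  module _ {t d : ℕ} (σ : Strategy t d) where
    private D = 2 ℕ.^ d

    -- The three summands come from the uniform queries, from erased points among the sums, and from
    -- collisions. Divided by `D * 2 ^ k` they are the rates `2 * k * M / D`, `M / 2 ^ k` and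
    -- `2 ^ k / D`.
    seed-hits : ∀ k s {M} → suc (2 * k) * t + erased s ≤ M →
      D * ∑ (seeds d k) (λ w → hits σ s (asked w)) ≤
      (D * D) ℕ.^ k * (2 ℕ.^ k * (2 * k * M) + (D * M + 2 ℕ.^ k * 2 ℕ.^ k))
    seed-hits k s {M} bound = begin
      D * ∑ (seeds d k) (λ w → hits σ s (asked w))
        ≡⟨ cong (D *_) (∑-cartesian _,_ (pairs d k) (points k) _) ⟩
      D * ∑ (pairs d k) (λ r → ∑ (points k) (λ c → hits σ s (flatten r ++ z r c ∷ [])))
        ≤⟨ ℕ.*-monoʳ-≤ D (∑-mono-≤ (pairs d k) per-pairs) ⟩
      D * ∑ (pairs d k) (λ r → K * hits σ s (flatten r) + (M + collisions (z r)))
        ≡⟨ cong (D *_) (trans (∑-+ (pairs d k) _ _) (cong₂ _+_ (∑-*ˡ (pairs d k) K _)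
             (trans (∑-+ (pairs d k) _ _) (cong (_+ C) (∑-pairs-const d k M))))) ⟩
      D * (K * H + (L * M + C))
        ≡⟨ distribute D K H L M C ⟩
      K * (D * H) + (D * (L * M) + D * C)
        ≤⟨ ℕ.+-mono-≤ (ℕ.*-monoʳ-≤ K (pairs-hits σ k s (ℕ.≤-trans (ℕ.+-monoˡ-≤ (erased s) (ℕ.m≤n+m (2 * k * t) t)) bound)))
             (ℕ.+-monoʳ-≤ (D * (L * M)) (∑-collisions d k)) ⟩
      K * (L * (2 * k * M)) + (D * (L * M) + L * (K * K))
        ≡⟨ collect K L (2 * k * M) D M ⟩
      L * (K * (2 * k * M) + (D * M + K * K)) ∎
      where
      open ℕ.≤-Reasoning
      K = 2 ℕ.^ k
      L = (D * D) ℕ.^ k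
      z : Pairs d k → Cube k → Cube d
      z r c = total (select c r)
      H = ∑ (pairs d k) (λ r → hits σ s (flatten r))
      C = ∑ (pairs d k) (λ r → collisions (z r))
      distribute : ∀ D K H L M C → D * (K * H + (L * M + C)) ≡ K * (D * H) + (D * (L * M) + D * C)
      distribute = solve-∀
      collect : ∀ K L X D M → K * (L * X) + (D * (L * M) + L * (K * K)) ≡ L * (K * X + (D * M + K * K))
      collect = solve-∀

      erased-after : ∀ r → erased (foldl (step σ) s (flatten r)) ≤ M
      erased-after r = begin
        erased (foldl (step σ) s (flatten r))  ≤⟨ erased-steps σ s (flatten r) ⟩
        length (flatten r) * t + erased s      ≡⟨ cong (λ l → l * t + erased s) (length-flatten r) ⟩
        2 * k * t + erased s                   ≤⟨ ℕ.+-monoˡ-≤ (erased s) (ℕ.m≤n+m (2 * k * t) t) ⟩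
        suc (2 * k) * t + erased s             ≤⟨ bound ⟩
        M                                      ∎

      -- The state reached after `flatten r` does not depend on the bits, so one and the same set of
      -- erasures faces all `2 ^ k` possible last queries.
      per-pairs : ∀ r → ∑ (points k) (λ c → hits σ s (flatten r ++ z r c ∷ [])) ≤ K * hits σ s (flatten r) + (M + collisions (z r))
      per-pairs r = begin
        ∑ (points k) (λ c → hits σ s (flatten r ++ z r c ∷ []))
          ≡⟨ ∑-cong (points k) (λ c → trans (hits-++ σ s (flatten r) (z r c ∷ [])) (cong (hits σ s (flatten r) +_) (ℕ.+-identityʳ _))) ⟩
        ∑ (points k) (λ c → hits σ s (flatten r) + missing (proj₂ s′ (z r c)))
          ≡⟨ trans (∑-+ (points k) _ _) (cong (_+ ∑ (points k) (λ c → missing (proj₂ s′ (z r c)))) (∑-points-const k _)) ⟩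
        K * hits σ s (flatten r) + ∑ (points k) (λ c → missing (proj₂ s′ (z r c)))
          ≤⟨ ℕ.+-monoʳ-≤ (K * hits σ s (flatten r)) (ℕ.≤-trans (last-query-bound s′ (z r)) (ℕ.+-monoˡ-≤ (collisions (z r)) (erased-after r))) ⟩
        K * hits σ s (flatten r) + (M + collisions (z r)) ∎
        where s′ = foldl (step σ) s (flatten r)

    module _ (k : ℕ) {M B : ℕ} (budget : B * (2 ℕ.^ k * (2 * k * M) + (D * M + 2 ℕ.^ k * 2 ℕ.^ k)) ≤ D * 2 ℕ.^ k) where
      private W = length (seeds d k)

      -- `budget` says that the three rates of `seed-hits` add up to at most `1 / B`.
      seed-hits-≤ : ∀ s → suc (2 * k) * t + erased s ≤ M → B * ∑ (seeds d k) (λ w → hits σ s (asked w)) ≤ W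
      seed-hits-≤ s bound = ℕ.*-cancelˡ-≤ D {{ℕ.m^n≢0 2 d}} (begin
        D * (B * H)                                        ≡⟨ left-commute D B H ⟩
        B * (D * H)                                        ≤⟨ ℕ.*-monoʳ-≤ B (seed-hits k s bound) ⟩
        B * (L * X)                                        ≡⟨ left-commute B L X ⟩
        L * (B * X)                                        ≤⟨ ℕ.*-monoʳ-≤ L budget ⟩
        L * (D * 2 ℕ.^ k)                                  ≡⟨ left-commute L D (2 ℕ.^ k) ⟩
        D * (L * 2 ℕ.^ k)                                  ≡⟨ cong (D *_) (length-seeds d k) ⟨
        D * W                                              ∎)
        where
        open ℕ.≤-Reasoning
        L = (D * D) ℕ.^ k
        H = ∑ (seeds d k) (λ w → hits σ s (asked w))
        X = 2 ℕ.^ k * (2 * k * M) + (D * M + 2 ℕ.^ k * 2 ℕ.^ k)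
        left-commute : ∀ u v w → u * (v * w) ≡ v * (u * w)
        left-commute = solve-∀

      -- Linearity of expectation. The state in which an iteration starts may depend on all earlier
      -- seeds, but `seed-hits-≤` holds from every state whose erasures stay within `M`.
      total-hits : ∀ N s → N * (suc (2 * k) * t) + erased s ≤ M →
                   B * ∑ (vectors (seeds d k) N) (λ ω → hits σ s (questions ω)) ≤ N * W ℕ.^ N
      total-hits zero    s bound = ℕ.≤-reflexive (ℕ.*-zeroʳ B)
      total-hits (suc N) s bound = begin
        B * ∑ (vectors (seeds d k) (suc N)) (λ ω → hits σ s (questions ω))
          ≡⟨ cong (B *_) (∑-cartesian _∷_ (seeds d k) (vectors (seeds d k) N) _) ⟩
        B * ∑ (seeds d k) (λ w → ∑ (vectors (seeds d k) N) (λ ω → hits σ s (asked w ++ questions ω)))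
          ≡⟨ cong (B *_) (∑-cong (seeds d k) per-seed) ⟩
        B * ∑ (seeds d k) (λ w → W ℕ.^ N * hits σ s (asked w) + rest w)
          ≡⟨ cong (B *_) (trans (∑-+ (seeds d k) _ _) (cong (_+ ∑ (seeds d k) rest) (∑-*ˡ (seeds d k) (W ℕ.^ N) _))) ⟩
        B * (W ℕ.^ N * H + ∑ (seeds d k) rest)
          ≡⟨ distribute B (W ℕ.^ N) H (∑ (seeds d k) rest) ⟩
        W ℕ.^ N * (B * H) + B * ∑ (seeds d k) rest
          ≡⟨ cong (W ℕ.^ N * (B * H) +_) (∑-*ˡ (seeds d k) B rest) ⟨
        W ℕ.^ N * (B * H) + ∑ (seeds d k) (λ w → B * rest w)
          ≤⟨ ℕ.+-mono-≤ (ℕ.*-monoʳ-≤ (W ℕ.^ N) (seed-hits-≤ s first-bound)) (∑-mono-≤ (seeds d k) (λ w → total-hits N (s′ w) (rest-bound w))) ⟩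
        W ℕ.^ N * W + ∑ (seeds d k) (λ w → N * W ℕ.^ N)
          ≡⟨ cong (W ℕ.^ N * W +_) (∑-const (seeds d k) _) ⟩
        W ℕ.^ N * W + W * (N * W ℕ.^ N)
          ≡⟨ collect (W ℕ.^ N) W N ⟩
        suc N * (W * W ℕ.^ N) ∎
        where
        open ℕ.≤-Reasoning
        H = ∑ (seeds d k) (λ w → hits σ s (asked w))
        s′ : Seed d k → State d
        s′ w = foldl (step σ) s (asked w)
        rest : Seed d k → ℕ
        rest w = ∑ (vectors (seeds d k) N) (λ ω → hits σ (s′ w) (questions ω))
        distribute : ∀ B V H R → B * (V * H + R) ≡ V * (B * H) + B * R
        distribute = solve-∀
        collect : ∀ V W N → V * W + W * (N * V) ≡ suc N * (W * V)
        collect = solve-∀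
        per-seed : ∀ w → ∑ (vectors (seeds d k) N) (λ ω → hits σ s (asked w ++ questions ω)) ≡ W ℕ.^ N * hits σ s (asked w) + rest w
        per-seed w = trans (∑-cong (vectors (seeds d k) N) (λ ω → hits-++ σ s (asked w) (questions ω)))
          (trans (∑-+ (vectors (seeds d k) N) _ _) (cong (_+ rest w) (∑-vectors-const (seeds d k) N _)))
        first-bound : suc (2 * k) * t + erased s ≤ M
        first-bound = ℕ.≤-trans (ℕ.+-monoˡ-≤ (erased s) (ℕ.m≤m+n (suc (2 * k) * t) (N * (suc (2 * k) * t)))) bound
        regroup : ∀ N Q e → N * Q + (Q + e) ≡ suc N * Q + e
        regroup = solve-∀
        rest-bound : ∀ w → N * (suc (2 * k) * t) + erased (s′ w) ≤ M
        rest-bound w = begin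
          N * Q + erased (s′ w)                        ≤⟨ ℕ.+-monoʳ-≤ (N * Q) (erased-steps σ s (asked w)) ⟩
          N * Q + (length (asked w) * t + erased s)    ≡⟨ cong (λ l → N * Q + (l * t + erased s)) (length-asked w) ⟩
          N * Q + (Q + erased s)                       ≡⟨ regroup N Q (erased s) ⟩
          suc N * Q + erased s                         ≤⟨ bound ⟩
          M                                            ∎
          where Q = suc (2 * k) * t

  -- Amplification by iteration, and soundness

  ^-distribʳ-* : ∀ k m n → (m * n) ℕ.^ k ≡ m ℕ.^ k * n ℕ.^ k
  ^-distribʳ-* zero    m n = refl
  ^-distribʳ-* (suc k) m n = trans (cong (m * n *_) (^-distribʳ-* k m n)) (interchange m n (m ℕ.^ k) (n ℕ.^ k))
    where
    interchange : ∀ a b c d → a * b * (c * d) ≡ a * c * (b * d)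
    interchange = solve-∀

  -- Bernoulli's inequality `1 + N / m ≤ (1 + 1 / m) ^ N` with denominators cleared.
  bernoulli : ∀ m N → (m + N) * m ℕ.^ N ≤ m * suc m ℕ.^ N
  bernoulli m zero    = ℕ.≤-reflexive (cong (_* 1) (ℕ.+-identityʳ m))
  bernoulli m (suc N) = begin
    (m + suc N) * (m * P)                      ≡⟨ expand m N P ⟩
    m * ((m + N) * P) + m * P                  ≤⟨ ℕ.+-monoʳ-≤ (m * ((m + N) * P)) (ℕ.*-monoˡ-≤ P (ℕ.m≤m+n m N)) ⟩
    m * ((m + N) * P) + (m + N) * P            ≡⟨ ℕ.+-comm _ ((m + N) * P) ⟩
    suc m * ((m + N) * P)                      ≤⟨ ℕ.*-monoʳ-≤ (suc m) (bernoulli m N) ⟩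
    suc m * (m * suc m ℕ.^ N)                  ≡⟨ left-commute (suc m) m _ ⟩
    m * (suc m * suc m ℕ.^ N)                  ∎
    where
    open ℕ.≤-Reasoning
    P = m ℕ.^ N
    expand : ∀ m N P → (m + suc N) * (m * P) ≡ m * ((m + N) * P) + m * P
    expand = solve-∀
    left-commute : ∀ u v w → u * (v * w) ≡ v * (u * w)
    left-commute = solve-∀

  -- By `bernoulli` with `N ≥ 5 m`, the power `(1 + 1 / m) ^ N` is at least 6.
  power-decay : ∀ m .{{_ : ℕ.NonZero m}} N V W → 5 * m ≤ N → suc m * V ≤ m * W → 6 * V ℕ.^ N ≤ W ℕ.^ N
  power-decay m {{m≢0}} N V W 5m≤N V≤W = ℕ.*-cancelˡ-≤ (m * suc m ℕ.^ N) {{ℕ.m*n≢0 m (suc m ℕ.^ N) {{m≢0}} {{ℕ.m^n≢0 (suc m) N}}}} (begin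
    m * suc m ℕ.^ N * (6 * V ℕ.^ N)       ≡⟨ regroup m (suc m ℕ.^ N) (V ℕ.^ N) ⟩
    6 * m * (suc m ℕ.^ N * V ℕ.^ N)       ≡⟨ cong (6 * m *_) (^-distribʳ-* N (suc m) V) ⟨
    6 * m * (suc m * V) ℕ.^ N             ≤⟨ ℕ.*-monoʳ-≤ (6 * m) (ℕ.^-monoˡ-≤ N V≤W) ⟩
    6 * m * (m * W) ℕ.^ N                 ≡⟨ cong (6 * m *_) (^-distribʳ-* N m W) ⟩
    6 * m * (m ℕ.^ N * W ℕ.^ N)           ≡⟨ ℕ.*-assoc (6 * m) _ _ ⟨
    6 * m * m ℕ.^ N * W ℕ.^ N             ≤⟨ ℕ.*-monoˡ-≤ (W ℕ.^ N) (ℕ.*-monoˡ-≤ (m ℕ.^ N) (ℕ.+-monoʳ-≤ m 5m≤N)) ⟩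
    (m + N) * m ℕ.^ N * W ℕ.^ N           ≤⟨ ℕ.*-monoˡ-≤ (W ℕ.^ N) (bernoulli m N) ⟩
    m * suc m ℕ.^ N * W ℕ.^ N             ∎)
    where
    open ℕ.≤-Reasoning
    regroup : ∀ m S V → m * S * (6 * V) ≡ 6 * m * (S * V)
    regroup = solve-∀

  -- An iteration passes with probability at most `m / suc m` for `m = 2 n + 1`, and `10 * suc n`
  -- exceeds `5 * m`, as `power-decay` requires for the bound 1/6.
  iterations : ℕ → ℕ
  iterations n = 10 * suc n

  initial : ∀ {d} → BoolFun d → State d
  initial f = [] , λ x → just (f x)

  erased-initial : ∀ {d} (f : BoolFun d) → erased (initial f) ≡ 0
  erased-initial {d} f = ∑ℕ.∑-zero (points d)

  -- Acceptance has two causes, each of probability at most 1/6: all checks pass without erasures,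
  -- by `power-decay`, or some answer is erased, by the last hypothesis and a union bound.
  soundness : ∀ {t d} (f : BoolFun d) (σ : Strategy t d) n {k} j → k ≡ 2 * suc j → let N = iterations n in
    (∀ S → 2 ℕ.^ d ≤ suc n * disagreements f S) →
    6 * ∑ (vectors (seeds d k) N) (λ ω → hits σ (initial f) (questions ω)) ≤ length (seeds d k) ℕ.^ N →
    3 * ∑ (vectors (seeds d k) N) (λ ω → ⟦ accepts f σ (verify ω true) ⟧) ≤ length (seeds d k) ℕ.^ N
  soundness {t} {d} f σ n j refl far few-hits = ℕ.*-cancelˡ-≤ 2 (begin
    2 * (3 * ∑ Ω (λ ω → ⟦ accepts f σ (verify ω true) ⟧))
      ≡⟨ ℕ.*-assoc 2 3 (∑ Ω (λ ω → ⟦ accepts f σ (verify ω true) ⟧)) ⟨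
    6 * ∑ Ω (λ ω → ⟦ accepts f σ (verify ω true) ⟧)
      ≤⟨ ℕ.*-monoʳ-≤ 6 (∑-mono-≤ Ω (λ ω → ℕ.≤-trans
           (execute≤run+hits σ (verify-asks ω true) [] (λ x → just (f x)) (λ x → inj₁ refl))
           (ℕ.≤-reflexive (cong (λ b → ⟦ b ⟧ + hits σ (initial f) (questions ω)) (run-verify f ω true))))) ⟩
    6 * ∑ Ω (λ ω → ⟦ all-pass f ω ⟧ + hits σ (initial f) (questions ω))
      ≡⟨ cong (6 *_) (trans (∑-+ Ω _ _) (cong (_+ H) (∑-all-pass {k = k} f N))) ⟩
    6 * (V ℕ.^ N + H)
      ≡⟨ ℕ.*-distribˡ-+ 6 (V ℕ.^ N) H ⟩
    6 * V ℕ.^ N + 6 * H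
      ≤⟨ ℕ.+-mono-≤ (power-decay (suc (n + n)) N V W 5m≤N pass-bound) few-hits ⟩
    W ℕ.^ N + W ℕ.^ N
      ≡⟨ cong (W ℕ.^ N +_) (ℕ.+-identityʳ _) ⟨
    2 * W ℕ.^ N ∎)
    where
    open ℕ.≤-Reasoning
    k = 2 * suc j
    N = iterations n
    D = 2 ℕ.^ d
    Ω = vectors (seeds d k) N
    W = length (seeds d k)
    V = ∑ (seeds d k) (λ (r , c) → ⟦ passes f (select c r) ⟧)
    P = ∑ (vectors (points d) k) (λ zs → ⟦ passes f zs ⟧)
    H = ∑ Ω (λ ω → hits σ (initial f) (questions ω))

    5m≤N : 5 * suc (n + n) ≤ N
    5m≤N = subst (5 * suc (n + n) ≤_) (slack n) (ℕ.m≤m+n _ 5)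
      where
      slack : ∀ n → 5 * suc (n + n) + 5 ≡ 10 * suc n
      slack = solve-∀

    pass-bound : suc (suc (n + n)) * V ≤ suc (n + n) * W
    pass-bound = begin
      suc (suc (n + n)) * V                              ≡⟨ cong (suc (suc (n + n)) *_) (∑-passes {k = k} f) ⟩
      suc (suc (n + n)) * (2 ℕ.^ k * (D ℕ.^ k * P))      ≡⟨ pull (suc (suc (n + n))) (2 ℕ.^ k) (D ℕ.^ k) P ⟩
      2 ℕ.^ k * D ℕ.^ k * (suc (suc (n + n)) * P)        ≤⟨ ℕ.*-monoʳ-≤ (2 ℕ.^ k * D ℕ.^ k) (passes-far f {n} far j) ⟩
      2 ℕ.^ k * D ℕ.^ k * (suc (n + n) * D ℕ.^ k)        ≡⟨ push (2 ℕ.^ k) (D ℕ.^ k) (suc (n + n)) ⟩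
      suc (n + n) * (D ℕ.^ k * D ℕ.^ k * 2 ℕ.^ k)        ≡⟨ cong (λ e → suc (n + n) * (e * 2 ℕ.^ k)) (^-distribʳ-* k D D) ⟨
      suc (n + n) * ((D * D) ℕ.^ k * 2 ℕ.^ k)            ≡⟨ cong (suc (n + n) *_) (length-seeds d k) ⟨
      suc (n + n) * W                                    ∎
      where
      pull : ∀ m K E P → m * (K * (E * P)) ≡ K * E * (m * P)
      pull = solve-∀
      push : ∀ K E m → K * E * (m * E) ≡ m * (E * E * K)
      push = solve-∀

  -- Serves `t = 0`: there the erasure budget holds for every `d` and cannot supply the lower bounds
  -- on `2 ^ d` that `few-hits` asks for.
  no-hits : ∀ {d} (σ : Strategy 0 d) s xs → erased s ≤ 0 → hits σ s xs ≡ 0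
  no-hits σ s []       none = refl
  no-hits {d} σ s (x ∷ xs) none = cong₂ _+_ (ℕ.n≤0⇒n≡0 (ℕ.≤-trans missing≤erased none))
    (no-hits σ (step σ s x) xs (ℕ.≤-trans (erased-step σ s x) none))
    where
    missing≤erased : missing (proj₂ s x) ≤ erased s
    missing≤erased = begin
      missing (proj₂ s x)                                ≡⟨ ∑-δ x (λ y → missing (proj₂ s y)) ⟨
      ∑ (points d) (λ y → δ x y * missing (proj₂ s y))   ≤⟨ ∑-mono-≤ (points d) (λ y → ℕ.≤-trans (ℕ.*-monoˡ-≤ (missing (proj₂ s y)) (⟦⟧≤1 (does (x ≟ y)))) (ℕ.≤-reflexive (ℕ.*-identityˡ _))) ⟩
      erased s                                           ∎
      where open ℕ.≤-Reasoning

  -- Each hypothesis bounds one of the three rates of `seed-hits` by `1 / (18 * N)`. Together they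
  -- allow `B = 6 * N`, and N iterations expect at most 1/6 of a hit. `M` counts all erasures of the
  -- whole run.
  few-hits : ∀ {t d} (f : BoolFun d) (σ : Strategy t d) k n → let N = iterations n; M = N * (suc (2 * k) * t) in
    18 * N * (2 * k * M) ≤ 2 ℕ.^ d → 18 * N * M ≤ 2 ℕ.^ k → 18 * N * 2 ℕ.^ k ≤ 2 ℕ.^ d →
    6 * ∑ (vectors (seeds d k) N) (λ ω → hits σ (initial f) (questions ω)) ≤ length (seeds d k) ℕ.^ N
  few-hits {t} {d} f σ k n first final collide = ℕ.*-cancelˡ-≤ N (begin
    N * (6 * H)     ≡⟨ ℕ.*-assoc N 6 H ⟨
    N * 6 * H       ≡⟨ cong (_* H) (ℕ.*-comm N 6) ⟩
    6 * N * H       ≤⟨ total-hits σ k {B = 6 * N} budget N (initial f) (ℕ.≤-reflexive (trans (cong (M +_) (erased-initial f)) (ℕ.+-identityʳ M))) ⟩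
    N * length (seeds d k) ℕ.^ N ∎)
    where
    open ℕ.≤-Reasoning
    N = iterations n
    M = N * (suc (2 * k) * t)
    D = 2 ℕ.^ d
    K = 2 ℕ.^ k
    H = ∑ (vectors (seeds d k) N) (λ ω → hits σ (initial f) (questions ω))
    budget : 6 * N * (K * (2 * k * M) + (D * M + K * K)) ≤ D * K
    budget = ℕ.*-cancelˡ-≤ 3 (begin
      3 * (6 * N * (K * (2 * k * M) + (D * M + K * K)))
        ≡⟨ expand N K (2 * k * M) D M ⟩
      18 * N * (2 * k * M) * K + (18 * N * M * D + 18 * N * K * K)
        ≤⟨ ℕ.+-mono-≤ (ℕ.*-monoˡ-≤ K first) (ℕ.+-mono-≤ (ℕ.*-monoˡ-≤ D final) (ℕ.*-monoˡ-≤ K collide)) ⟩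
      D * K + (K * D + D * K)
        ≡⟨ triple D K ⟩
      3 * (D * K) ∎)
      where
      expand : ∀ N K X D M → 3 * (6 * N * (K * X + (D * M + K * K))) ≡ 18 * N * X * K + (18 * N * M * D + 18 * N * K * K)
      expand = solve-∀
      triple : ∀ D K → D * K + (K * D + D * K) ≡ 3 * (D * K)
      triple = solve-∀

module _ where
  open import Data.Fin.Base using (Fin; zero; suc)
  open import Data.Integer.Base using (+_; +≤+)
  open import Data.Nat.Base using (_+_; _*_; _≤_)
  open import Data.Nat.Tactic.RingSolver using (solve-∀)
  open import Data.Rational.Unnormalised.Base using (*≤*)
  open ∑ℕ using (∑; ∑-cong; ∑-+)

  -- Uniform choices and probabilities

  -- Coins range over a nonempty set, so the empty list needs a default. It accepts, in accordance
  -- with one-sidedness.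
  uniform : ∀ {A : Set} {d} → List A → (A → Algorithm d) → RandomizedAlgorithm d
  uniform []       g = record { coins-1 = 0 ; branch = λ _ → output true }
  uniform (x ∷ xs) g = record { coins-1 = length xs ; branch = λ i → g (lookup (x ∷ xs) i) }

  uniform-all : ∀ {A : Set} {d} {P : Algorithm d → Set} (xs : List A) {g} → P (output true) → (∀ x → P (g x)) →
                ∀ ω → P (branch (uniform xs g) ω)
  uniform-all []       p-true p ω = p-true
  uniform-all (x ∷ xs) p-true p ω = p (lookup (x ∷ xs) ω)

  length-filter : ∀ {A : Set} {P : A → Set} (P? : Decidable P) xs → length (filter P? xs) ≡ ∑ xs (λ x → ⟦ does (P? x) ⟧)
  length-filter P? []       = refl
  length-filter P? (x ∷ xs) with does (P? x)
  ... | true  = cong suc (length-filter P? xs)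
  ... | false = length-filter P? xs

  ∑-tabulate : ∀ {A B : Set} (xs : List A) (φ : Fin (length xs) → B) {F : B → ℕ} {G : A → ℕ} →
               (∀ i → F (φ i) ≡ G (lookup xs i)) → ∑ (tabulate φ) F ≡ ∑ xs G
  ∑-tabulate []       φ eq = refl
  ∑-tabulate (x ∷ xs) φ eq = cong₂ _+_ (eq zero) (∑-tabulate xs (λ i → φ (suc i)) (λ i → eq (suc i)))

  /-mono-≤ : ∀ a m b n → a * suc n ≤ b * suc m → + a / suc m ℚ.≤ + b / suc n
  /-mono-≤ a m b n le = ℚ.toℚᵘ-cancel-≤ (begin
    ℚ.toℚᵘ (+ a / suc m)  ≃⟨ ℚ.toℚᵘ-fromℚᵘ (mkℚᵘ (+ a) m) ⟩
    mkℚᵘ (+ a) m          ≤⟨ *≤* (subst₂ Data.Integer.Base._≤_ (ℤ.pos-* a (suc n)) (ℤ.pos-* b (suc m)) (+≤+ le)) ⟩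
    mkℚᵘ (+ b) n          ≃⟨ ℚᵘ.≃-sym (ℚ.toℚᵘ-fromℚᵘ (mkℚᵘ (+ b) n)) ⟩
    ℚ.toℚᵘ (+ b / suc n)  ∎)
    where open ℚᵘ.≤-Reasoning

  Pr-certain : ∀ {n} (event : Fin (suc n) → Bool) → (∀ ω → event ω ≡ true) → Pr event ≡ 1ℚ
  Pr-certain {n} event certain = trans (cong (λ c → + c / suc n) count)
    (ℚ.fromℚᵘ-cong {mkℚᵘ (+ suc n) n} {mkℚᵘ (+ 1) 0} (*≡* (ℤ.*-comm (+ suc n) (+ 1))))
    where
    count : length (filterᵇ event (allFin (suc n))) ≡ suc n
    count = trans (length-filter _ (allFin (suc n)))
      (trans (∑-cong (allFin (suc n)) (λ ω → cong ⟦_⟧ (certain ω)))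
        (trans (∑-1 (allFin (suc n))) (List.length-tabulate id)))

  Pr-uniform-≥⅔ : ∀ {A : Set} {d} (xs : List A) (g : A → Algorithm d) (E : Algorithm d → Bool) → 0 ℕ.< length xs →
    3 * ∑ xs (λ x → ⟦ E (g x) ⟧) ≤ length xs → + 2 / 3 ℚ.≤ Pr (λ ω → not (E (branch (uniform xs g) ω)))
  Pr-uniform-≥⅔ l@(x ∷ xs) g E _ few = /-mono-≤ 2 2 rejected (length xs)
    (subst (λ c → 2 * length l ≤ c * 3) (sym count) (ℕ.+-cancelˡ-≤ (3 * a) _ _ (begin
      3 * a + 2 * length l        ≤⟨ ℕ.+-monoˡ-≤ (2 * length l) few ⟩
      length l + 2 * length l     ≡⟨ triple (length l) ⟩
      length l * 3                ≡⟨ cong (_* 3) a+b ⟨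
      (a + b) * 3                 ≡⟨ distribute a b ⟩
      3 * a + b * 3               ∎)))
    where
    open ℕ.≤-Reasoning
    a = ∑ l (λ x → ⟦ E (g x) ⟧)
    b = ∑ l (λ x → ⟦ not (E (g x)) ⟧)
    triple : ∀ l → l + 2 * l ≡ l * 3
    triple = solve-∀
    distribute : ∀ a b → (a + b) * 3 ≡ 3 * a + b * 3
    distribute = solve-∀
    complement : ∀ e → ⟦ e ⟧ + ⟦ not e ⟧ ≡ 1
    complement false = refl
    complement true  = refl
    a+b : a + b ≡ length l
    a+b = trans (sym (∑-+ l (λ x → ⟦ E (g x) ⟧) (λ x → ⟦ not (E (g x)) ⟧))) (trans (∑-cong l (λ x → complement (E (g x)))) (∑-1 l))
    rejected = length (filterᵇ (λ ω → not (E (branch (uniform l g) ω))) (allFin (length l)))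
    count : rejected ≡ b
    count = trans (length-filter _ (allFin (length l))) (∑-tabulate l id (λ i → refl))

  -- Distances

  distance-parity : ∀ {d} (f : BoolFun d) S →
    distance f (parity S) ≡ (+ disagreements f S / 2 ℕ.^ d) {{ℕ.m^n≢0 2 d}}
  distance-parity {d} f S = cong (λ c → (+ c / 2 ℕ.^ d) {{ℕ.m^n≢0 2 d}})
    (trans (length-filter _ (points d)) (∑-cong (points d) (λ x → cong ⟦_⟧ (differ (f x) (parity S x)))))
    where
    differ : ∀ a b → not (does (a Bool.≟ b)) ≡ a xor b
    differ false false = refl
    differ false true  = refl
    differ true  false = refl
    differ true  true  = refl

  -- On the half of the cube where the first coordinate is `false` the two parities coincide and a
  -- point counts at most twice; on the other half they are opposite and it counts once. On average
  -- this is 3/4 of the cube.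
  two-parities : ∀ {d} (f : BoolFun (suc d)) S →
    disagreements f (false ∷ S) + disagreements f (true ∷ S) ≤ 3 * 2 ℕ.^ d
  two-parities {d} f S = begin
    disagreements f (false ∷ S) + disagreements f (true ∷ S)
      ≡⟨ ∑-+ (points (suc d)) _ _ ⟨
    ∑ (points (suc d)) (λ x → ⟦ f x xor parity (false ∷ S) x ⟧ + ⟦ f x xor parity (true ∷ S) x ⟧)
      ≡⟨ ∑ℕ.∑-points d _ ⟩
    ∑ (points d) (λ x → ⟦ f (false ∷ x) xor parity S x ⟧ + ⟦ f (false ∷ x) xor parity S x ⟧) +
    ∑ (points d) (λ x → ⟦ f (true ∷ x) xor parity S x ⟧ + ⟦ f (true ∷ x) xor not (parity S x) ⟧)
      ≤⟨ ℕ.+-mono-≤ (∑-mono-≤ (points d) (λ x → ℕ.+-mono-≤ (⟦⟧≤1 (f (false ∷ x) xor parity S x)) (⟦⟧≤1 (f (false ∷ x) xor parity S x))))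
                    (∑-mono-≤ (points d) (λ x → opposite (f (true ∷ x)) (parity S x))) ⟩
    ∑ (points d) (λ x → 2) + ∑ (points d) (λ x → 1)
      ≡⟨ cong₂ _+_ (∑-points-const d 2) (∑-points-const d 1) ⟩
    2 ℕ.^ d * 2 + 2 ℕ.^ d * 1
      ≡⟨ triple (2 ℕ.^ d) ⟩
    3 * 2 ℕ.^ d ∎
    where
    open ℕ.≤-Reasoning
    triple : ∀ D → D * 2 + D * 1 ≡ 3 * D
    triple = solve-∀
    opposite : ∀ a b → ⟦ a xor b ⟧ + ⟦ a xor not b ⟧ ≤ 1
    opposite false false = s≤s z≤n
    opposite false true  = s≤s z≤n
    opposite true  false = s≤s z≤n
    opposite true  true  = s≤s z≤n

  -- Parameters

  log-bounds : ∀ u → ∃ λ ℓ → suc u ≤ 2 ℕ.^ ℓ × 2 ℕ.^ ℓ ≤ 2 * suc u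
  log-bounds zero    = 0 , s≤s z≤n , s≤s z≤n
  log-bounds (suc u) with log-bounds u
  ... | ℓ , lower , upper with suc (suc u) ℕ.≤? 2 ℕ.^ ℓ
  ...   | yes p = ℓ , p , ℕ.≤-trans upper (ℕ.*-monoʳ-≤ 2 (ℕ.n≤1+n (suc u)))
  ...   | no ¬p = suc ℓ , double , ℕ.*-monoʳ-≤ 2 (ℕ.<⇒≤ (ℕ.≰⇒> ¬p))
    where
    double : suc (suc u) ≤ 2 * 2 ℕ.^ ℓ
    double = ℕ.≤-trans (s≤s (ℕ.m≤n+m (suc u) u)) (ℕ.≤-trans (ℕ.≤-reflexive (cong (suc u ℕ.+_) (sym (ℕ.+-identityʳ (suc u))))) (ℕ.*-monoʳ-≤ 2 lower))

  n<2^n : ∀ n → n ℕ.< 2 ℕ.^ n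
  n<2^n zero    = s≤s z≤n
  n<2^n (suc n) = begin
    suc (suc n)              ≤⟨ s≤s (ℕ.m≤n+m (suc n) n) ⟩
    suc n + suc n            ≤⟨ ℕ.+-mono-≤ (n<2^n n) (n<2^n n) ⟩
    2 ℕ.^ n + 2 ℕ.^ n        ≡⟨ cong (2 ℕ.^ n ℕ.+_) (ℕ.+-identityʳ (2 ℕ.^ n)) ⟨
    2 ℕ.^ suc n              ∎
    where open ℕ.≤-Reasoning

module _ where
  open import Data.Nat.Base using (_+_; _*_; _≤_)
  open import Data.Nat.Tactic.RingSolver using (solve-∀)

  -- n stands for the integer suc n: then 128 t n ≤ 2 ^ depth ≤ 256 t n, and 2 ^ width is of the order of (t n)^4.
  depth : ℕ → ℕ → ℕ
  depth t n = 7 + proj₁ (log-bounds (n + ℕ.pred t * suc n))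

  -- Four times `depth`, so that `2 ^ width` is a fourth power, with an outer factor 2 that makes
  -- the width visibly even.
  width : ℕ → ℕ → ℕ
  width t n = 2 * (2 * depth t n)

  module _ (t₀ n₀ : ℕ) where
    private
      t = suc t₀
      n = suc n₀
      L = depth t n₀
      X = 2 ℕ.^ L
      k = width t n₀
      N = iterations n₀
      Q = suc (2 * k)
      M = N * (Q * t)
      ℓ = proj₁ (log-bounds (n₀ + t₀ * n))
      open ℕ.≤-Reasoning

      X≡ : X ≡ 128 * 2 ℕ.^ ℓ
      X≡ = ℕ.^-distribˡ-+-* 2 7 ℓ

      lower : 128 * (t * n) ≤ X
      lower = subst (128 * (t * n) ≤_) (sym X≡) (ℕ.*-monoʳ-≤ 128 (proj₁ (proj₂ (log-bounds (n₀ + t₀ * n)))))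

    depth-upper : 2 ℕ.^ depth (suc t₀) n₀ ≤ 256 * (suc t₀ * suc n₀)
    depth-upper = begin
      X                    ≡⟨ X≡ ⟩
      128 * 2 ℕ.^ ℓ        ≤⟨ ℕ.*-monoʳ-≤ 128 (proj₂ (proj₂ (log-bounds (n₀ + t₀ * n)))) ⟩
      128 * (2 * (t * n))  ≡⟨ ℕ.*-assoc 128 2 (t * n) ⟨
      256 * (t * n)        ∎

    private
      1≤X : 1 ≤ X
      1≤X = ℕ.m^n>0 2 L

      width-power : 2 ℕ.^ k ≡ X ℕ.^ 4
      width-power = trans (cong (2 ℕ.^_) (exponent L)) (sym (ℕ.^-*-assoc 2 L 4))
        where
        exponent : ∀ L → 2 * (2 * L) ≡ L * 4
        exponent = solve-∀

      -- A logarithmic quantity bounded crudely by a linear one; the fourth power of `X` has room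
      -- for it.
      Q≤8X : Q ≤ 8 * X
      Q≤8X = begin
        Q               ≤⟨ ℕ.m≤n+m Q 7 ⟩
        7 + Q           ≡⟨ eight L ⟩
        8 * suc L       ≤⟨ ℕ.*-monoʳ-≤ 8 (n<2^n L) ⟩
        8 * X           ∎
        where
        eight : ∀ L → 7 + suc (2 * (2 * (2 * L))) ≡ 8 * suc L
        eight = solve-∀

      X³≤X⁴ : X * X * X ≤ X ℕ.^ 4
      X³≤X⁴ = begin
        X * X * X               ≡⟨ ℕ.*-identityʳ (X * X * X) ⟨
        X * X * X * 1           ≤⟨ ℕ.*-monoʳ-≤ (X * X * X) 1≤X ⟩
        X * X * X * X           ≡⟨ power X ⟩
        X ℕ.^ 4                 ∎
        where
        power : ∀ X → X * X * X * X ≡ X * (X * (X * (X * 1)))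
        power = solve-∀

      Y = t ℕ.^ 4 * n ℕ.^ 5

      -- The collision cost requires `D` to exceed a multiple of `n * X ^ 4`. As `X` is `t * n` up
      -- to a constant, this is `Y`, the origin of the exponents 5/4 and 1/4 in the erasure budget.
      nX⁴≤ : n * X ℕ.^ 4 ≤ 2 ℕ.^ 32 * Y
      nX⁴≤ = begin
        n * X ℕ.^ 4                                ≤⟨ ℕ.*-monoʳ-≤ n (ℕ.^-monoˡ-≤ 4 depth-upper) ⟩
        n * (256 * (t * n)) ℕ.^ 4                  ≡⟨ cong (n *_) (trans (^-distribʳ-* 4 256 (t * n)) (cong (256 ℕ.^ 4 *_) (^-distribʳ-* 4 t n))) ⟩
        n * (256 ℕ.^ 4 * (t ℕ.^ 4 * n ℕ.^ 4))      ≡⟨ regroup n (256 ℕ.^ 4) (t ℕ.^ 4) (n ℕ.^ 4) ⟩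
        256 ℕ.^ 4 * (t ℕ.^ 4 * (n * n ℕ.^ 4))      ∎
        where
        regroup : ∀ n a b c → n * (a * (b * c)) ≡ a * (b * (n * c))
        regroup = solve-∀

    final-bound : let k = width (suc t₀) n₀; N = iterations n₀ in
      18 * N * (N * (suc (2 * k) * suc t₀)) ≤ 2 ℕ.^ k
    final-bound = begin
      18 * (10 * n) * (10 * n * (Q * t))        ≡⟨ regroup₁ n t Q ⟩
      1800 * (n * n * t * Q)                    ≤⟨ ℕ.*-monoʳ-≤ 1800 (ℕ.*-monoʳ-≤ (n * n * t) Q≤8X) ⟩
      1800 * (n * n * t * (8 * X))              ≡⟨ regroup₂ (n * n * t) X ⟩
      -- The constant 14400 collects 18, 10, 10 and 8; it stays below the square of 128, the factor
      -- that the summand 7 in `depth` provides.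
      14400 * (n * n * t * X)                   ≤⟨ ℕ.*-monoˡ-≤ (n * n * t * X) (ℕ.≤ᵇ⇒≤ 14400 16384 tt) ⟩
      16384 * (n * n * t * X)                   ≤⟨ ℕ.*-monoʳ-≤ 16384 (ℕ.*-monoˡ-≤ X (ℕ.m≤n*m (n * n * t) t)) ⟩
      16384 * (t * (n * n * t) * X)             ≡⟨ regroup₃ t n X ⟩
      128 * (t * n) * (128 * (t * n)) * X       ≤⟨ ℕ.*-monoˡ-≤ X (ℕ.*-mono-≤ lower lower) ⟩
      X * X * X                                 ≤⟨ X³≤X⁴ ⟩
      X ℕ.^ 4                                   ≡⟨ width-power ⟨
      2 ℕ.^ k                                   ∎
      where
      regroup₁ : ∀ n t Q → 18 * (10 * n) * (10 * n * (Q * t)) ≡ 1800 * (n * n * t * Q)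
      regroup₁ = solve-∀
      regroup₂ : ∀ a X → 1800 * (a * (8 * X)) ≡ 14400 * (a * X)
      regroup₂ = solve-∀
      regroup₃ : ∀ t n X → 16384 * (t * (n * n * t) * X) ≡ 128 * (t * n) * (128 * (t * n)) * X
      regroup₃ = solve-∀

    module _ {D : ℕ} (large : 2 ℕ.^ 43 * (suc t₀ ℕ.^ 4 * suc n₀ ℕ.^ 5) ≤ D) where
      private
        -- The exponent 43 leaves a factor `2 ^ 11` beyond the `2 ^ 32` of `nX⁴≤`, enough for the
        -- constants 180 and 900.
        scaled : ∀ c → c * 2 ℕ.^ 32 ≤ 2 ℕ.^ 43 → c * (n * X ℕ.^ 4) ≤ D
        scaled c le = begin
          c * (n * X ℕ.^ 4)      ≤⟨ ℕ.*-monoʳ-≤ c nX⁴≤ ⟩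
          c * (2 ℕ.^ 32 * Y)     ≡⟨ ℕ.*-assoc c (2 ℕ.^ 32) Y ⟨
          c * 2 ℕ.^ 32 * Y       ≤⟨ ℕ.*-monoˡ-≤ Y le ⟩
          2 ℕ.^ 43 * Y           ≤⟨ large ⟩
          D                      ∎

      collision-budget : 18 * iterations n₀ * 2 ℕ.^ width (suc t₀) n₀ ≤ D
      collision-budget = begin
        18 * (10 * n) * 2 ℕ.^ k    ≡⟨ cong (18 * (10 * n) *_) width-power ⟩
        18 * (10 * n) * X ℕ.^ 4    ≡⟨ regroup n (X ℕ.^ 4) ⟩
        180 * (n * X ℕ.^ 4)        ≤⟨ scaled 180 (ℕ.≤ᵇ⇒≤ _ _ tt) ⟩
        D                          ∎
        where
        regroup : ∀ n P → 18 * (10 * n) * P ≡ 180 * (n * P)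
        regroup = solve-∀

      first-bound : let k = width (suc t₀) n₀; N = iterations n₀ in
        18 * N * (2 * k * (N * (suc (2 * k) * suc t₀))) ≤ D
      first-bound = begin
        18 * (10 * n) * (2 * k * (10 * n * (Q * t)))    ≤⟨ ℕ.*-monoʳ-≤ (18 * (10 * n)) (ℕ.*-monoˡ-≤ (10 * n * (Q * t)) (ℕ.n≤1+n (2 * k))) ⟩
        18 * (10 * n) * (Q * (10 * n * (Q * t)))        ≡⟨ regroup₁ n Q t ⟩
        1800 * (n * (t * n) * (Q * Q))                  ≤⟨ ℕ.*-monoʳ-≤ 1800 (ℕ.*-monoʳ-≤ (n * (t * n)) (ℕ.*-mono-≤ Q≤8X Q≤8X)) ⟩
        1800 * (n * (t * n) * (8 * X * (8 * X)))        ≡⟨ regroup₂ n (t * n) X ⟩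
        900 * (n * (128 * (t * n) * X * X))             ≤⟨ ℕ.*-monoʳ-≤ 900 (ℕ.*-monoʳ-≤ n (ℕ.*-monoˡ-≤ X (ℕ.*-monoˡ-≤ X lower))) ⟩
        900 * (n * (X * X * X))                         ≤⟨ ℕ.*-monoʳ-≤ 900 (ℕ.*-monoʳ-≤ n X³≤X⁴) ⟩
        900 * (n * X ℕ.^ 4)                             ≤⟨ scaled 900 (ℕ.≤ᵇ⇒≤ _ _ tt) ⟩
        D                                               ∎
        where
        regroup₁ : ∀ n Q t → 18 * (10 * n) * (Q * (10 * n * (Q * t))) ≡ 1800 * (n * (t * n) * (Q * Q))
        regroup₁ = solve-∀
        regroup₂ : ∀ n u X → 1800 * (n * u * (8 * X * (8 * X))) ≡ 900 * (n * (128 * u * X * X))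
        regroup₂ = solve-∀

    query-count : suc (2 * width (suc t₀) n₀) ≤ 9 * depth (suc t₀) n₀
    query-count = begin
      suc (2 * (2 * (2 * L)))    ≡⟨ eight L ⟩
      8 * L + 1                  ≤⟨ ℕ.+-monoʳ-≤ (8 * L) (s≤s z≤n) ⟩
      8 * L + L                  ≡⟨ nine L ⟩
      9 * L                      ∎
      where
      eight : ∀ L → suc (2 * (2 * (2 * L))) ≡ 8 * L + 1
      eight = solve-∀
      nine : ∀ L → 8 * L + L ≡ 9 * L
      nine = solve-∀

-- Rational bounds

module _ where
  open import Data.Integer.Base using (+_; +[1+_]; +≤+)
  open import Data.Nat.Tactic.RingSolver using (solve-∀)
  open import Data.Rational.Base using (_*_; _≤_; *≤*)

  toℚᵘ-fromℕ : ∀ n → ℚ.toℚᵘ (fromℕ n) ℚᵘ.≃ mkℚᵘ (+ n) 0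
  toℚᵘ-fromℕ n = ℚ.toℚᵘ-fromℚᵘ (mkℚᵘ (+ n) 0)

  fromℕ-* : ∀ m n → fromℕ (m ℕ.* n) ≡ fromℕ m * fromℕ n
  fromℕ-* m n = ℚ.toℚᵘ-injective (begin
    ℚ.toℚᵘ (fromℕ (m ℕ.* n))                 ≈⟨ toℚᵘ-fromℕ (m ℕ.* n) ⟩
    mkℚᵘ (+ (m ℕ.* n)) 0                     ≡⟨ cong (λ i → mkℚᵘ i 0) (ℤ.pos-* m n) ⟩
    mkℚᵘ (+ m) 0 ℚᵘ.* mkℚᵘ (+ n) 0           ≈⟨ ℚᵘ.*-cong (toℚᵘ-fromℕ m) (toℚᵘ-fromℕ n) ⟨
    ℚ.toℚᵘ (fromℕ m) ℚᵘ.* ℚ.toℚᵘ (fromℕ n)   ≈⟨ ℚ.toℚᵘ-homo-* (fromℕ m) (fromℕ n) ⟨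
    ℚ.toℚᵘ (fromℕ m * fromℕ n)               ∎)
    where open ℚᵘ.≃-Reasoning

  fromℕ-^ : ∀ m k → fromℕ (m ℕ.^ k) ≡ fromℕ m ^ k
  fromℕ-^ m zero    = refl
  fromℕ-^ m (suc k) = trans (fromℕ-* m (m ℕ.^ k)) (cong (fromℕ m *_) (fromℕ-^ m k))

  fromℕ-mono-≤ : ∀ {m n} → m ℕ.≤ n → fromℕ m ≤ fromℕ n
  fromℕ-mono-≤ {m} {n} m≤n = /-mono-≤ m 0 n 0 (ℕ.*-monoˡ-≤ 1 m≤n)

  fromℕ-nonNeg : ∀ n → NonNegative (fromℕ n)
  fromℕ-nonNeg n = ℚ.normalize-nonNeg n 1

  ≤-/⁻¹ : ∀ ε c D .{{_ : ℕ.NonZero D}} → ε ≤ + c / D → ↥ ε ℤ.* + D ℤ.≤ + c ℤ.* ↧ ε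
  ≤-/⁻¹ ε@record{} c (suc m) le = ℚᵘ.drop-*≤* (ℚᵘ.≤-respʳ-≃ (ℚ.toℚᵘ-fromℚᵘ (mkℚᵘ (+ c) m)) (ℚ.toℚᵘ-mono-≤ le))

  fromℕ-cancel-≤ : ∀ {m n} → fromℕ m ≤ fromℕ n → m ℕ.≤ n
  fromℕ-cancel-≤ {m} {n} le = ℤ.drop‿+≤+ (subst₂ ℤ._≤_ (ℤ.*-identityʳ (+ m)) (ℤ.*-identityʳ (+ n))
    (ℚᵘ.drop-*≤* (ℚᵘ.≤-respˡ-≃ (toℚᵘ-fromℕ m) (ℚᵘ.≤-respʳ-≃ (toℚᵘ-fromℕ n) (ℚ.toℚᵘ-mono-≤ le)))))

  ^-nonNeg : ∀ x .{{_ : NonNegative x}} k → NonNegative (x ^ k)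
  ^-nonNeg x zero    = _
  ^-nonNeg x (suc k) = ℚ.nonNeg*nonNeg⇒nonNeg x (x ^ k) {{^-nonNeg x k}}

  *-mono-≤-nonNeg : ∀ {p q r s} .{{_ : NonNegative q}} .{{_ : NonNegative r}} → p ≤ q → r ≤ s → p * r ≤ q * s
  *-mono-≤-nonNeg {q = q} {r = r} p≤q r≤s = ℚ.≤-trans (ℚ.*-monoʳ-≤-nonNeg r p≤q) (ℚ.*-monoˡ-≤-nonNeg q r≤s)

  ^-monoˡ-≤-nonNeg : ∀ k {x y} .{{_ : NonNegative x}} .{{_ : NonNegative y}} → x ≤ y → x ^ k ≤ y ^ k
  ^-monoˡ-≤-nonNeg zero                            x≤y = ℚ.≤-refl
  ^-monoˡ-≤-nonNeg (suc k) {x} {y} {{_}} {{y≥0}} x≤y = *-mono-≤-nonNeg {{y≥0}} {{^-nonNeg x k}} x≤y (^-monoˡ-≤-nonNeg k x≤y)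

  1≤^ : ∀ x k → 1ℚ ≤ x → 1ℚ ≤ x ^ k
  1≤^ x zero    1≤x = ℚ.≤-refl
  1≤^ x (suc k) 1≤x = *-mono-≤-nonNeg {1ℚ} {x} {1ℚ} {{ℚ.nonNegative (ℚ.≤-trans (toWitness {a? = 0ℚ ℚ.≤? 1ℚ} tt) 1≤x)}} 1≤x (1≤^ x k 1≤x)

  -- For ε > 0 this is ⌊1/ε⌋, so that 1 ≤ ε * (1 + scale ε) ≤ 2 when ε ≤ 1; the value 0 at ε ≤ 0 is junk.
  scale : ℚ → ℕ
  scale (mkℚ +[1+ p ] q-1 _) = suc q-1 ℕ./ suc p
  scale _                    = 0

  scale-lower : ∀ ε .{{_ : Positive ε}} → ↧ₙ ε ℕ.≤ suc (scale ε) ℕ.* ∣ ↥ ε ∣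
  scale-lower (mkℚ +[1+ p ] q-1 _) = begin
    q                                          ≡⟨ ℕ.m≡m%n+[m/n]*n q (suc p) ⟩
    q ℕ.% suc p ℕ.+ q ℕ./ suc p ℕ.* suc p      ≤⟨ ℕ.+-monoˡ-≤ _ (ℕ.<⇒≤ (ℕ.m%n<n q (suc p))) ⟩
    suc p ℕ.+ q ℕ./ suc p ℕ.* suc p            ∎
    where
    open ℕ.≤-Reasoning
    q = suc q-1

  scale-upper : ∀ ε .{{_ : Positive ε}} → ε ≤ 1ℚ → suc (scale ε) ℕ.* ∣ ↥ ε ∣ ℕ.≤ 2 ℕ.* ↧ₙ ε
  scale-upper ε@(mkℚ +[1+ p ] q-1 _) ε≤1 = begin
    suc p ℕ.+ q ℕ./ suc p ℕ.* suc p            ≤⟨ ℕ.+-mono-≤ p≤q (ℕ.m/n*n≤m q (suc p)) ⟩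
    q ℕ.+ q                                    ≡⟨ cong (q ℕ.+_) (ℕ.+-identityʳ q) ⟨
    2 ℕ.* q                                    ∎
    where
    open ℕ.≤-Reasoning
    q = suc q-1
    p≤q : suc p ℕ.≤ q
    p≤q = ℤ.drop‿+≤+ (subst₂ ℤ._≤_ (ℤ.*-identityʳ (+ suc p)) (ℤ.*-identityˡ (+ q)) (ℚ.drop-*≤* ε≤1))

  ε·n≤2 : ∀ ε .{{_ : Positive ε}} → ε ≤ 1ℚ → ε * fromℕ (suc (scale ε)) ≤ fromℕ 2
  ε·n≤2 ε@(mkℚ +[1+ p ] q-1 _) ε≤1 = ℚ.toℚᵘ-cancel-≤ (begin
    ℚ.toℚᵘ (ε * fromℕ n)                  ≃⟨ ℚ.toℚᵘ-homo-* ε (fromℕ n) ⟩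
    ℚ.toℚᵘ ε ℚᵘ.* ℚ.toℚᵘ (fromℕ n)        ≃⟨ ℚᵘ.*-congˡ {ℚ.toℚᵘ ε} (toℚᵘ-fromℕ n) ⟩
    ℚ.toℚᵘ ε ℚᵘ.* mkℚᵘ (+ n) 0            ≤⟨ ℚᵘ.*≤* (+≤+ cross) ⟩
    mkℚᵘ (+ 2) 0                          ≃⟨ ℚᵘ.≃-sym (toℚᵘ-fromℕ 2) ⟩
    ℚ.toℚᵘ (fromℕ 2)                      ∎)
    where
    n = suc (scale ε)
    open ℚᵘ.≤-Reasoning
    cross : suc p ℕ.* n ℕ.* 1 ℕ.≤ 2 ℕ.* (suc q-1 ℕ.* 1)
    cross = subst₂ ℕ._≤_ (trans (ℕ.*-comm n (suc p)) (sym (ℕ.*-identityʳ _))) (cong (2 ℕ.*_) (sym (ℕ.*-identityʳ (suc q-1)))) (scale-upper ε ε≤1)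

  far-parity : ∀ {d} ε .{{_ : Positive ε}} {f : BoolFun d} → Far ε (Linear d) f → ∀ S →
               ∣ ↥ ε ∣ ℕ.* 2 ℕ.^ d ℕ.≤ disagreements f S ℕ.* ↧ₙ ε
  far-parity {d} ε@(mkℚ +[1+ p ] q-1 _) {f} far S =
    ℤ.drop‿+≤+ (subst₂ ℤ._≤_ (sym (ℤ.pos-* (suc p) (2 ℕ.^ d))) (sym (ℤ.pos-* (disagreements f S) (suc q-1)))
      (≤-/⁻¹ ε (disagreements f S) (2 ℕ.^ d) {{ℕ.m^n≢0 2 d}} (subst (ε ≤_) (distance-parity f S) (far (parity S) (S , λ _ → refl)))))

  far-scaled : ∀ {d} ε .{{_ : Positive ε}} {f : BoolFun d} → Far ε (Linear d) f → ∀ S →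
               2 ℕ.^ d ℕ.≤ suc (scale ε) ℕ.* disagreements f S
  far-scaled {d} ε@(mkℚ +[1+ p ] q-1 _) {f} far S = ℕ.*-cancelˡ-≤ (suc p) (begin
    suc p ℕ.* 2 ℕ.^ d                               ≤⟨ far-parity ε far S ⟩
    disagreements f S ℕ.* suc q-1                   ≤⟨ ℕ.*-monoʳ-≤ (disagreements f S) (scale-lower ε) ⟩
    disagreements f S ℕ.* (suc (scale ε) ℕ.* suc p) ≡⟨ rotate (disagreements f S) (suc (scale ε)) (suc p) ⟩
    suc p ℕ.* (suc (scale ε) ℕ.* disagreements f S) ∎)
    where
    open ℕ.≤-Reasoning
    rotate : ∀ a b c → a ℕ.* (b ℕ.* c) ≡ c ℕ.* (b ℕ.* a)
    rotate = solve-∀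

  -- Farness from both parities of `two-parities`, averaged. A coordinate is needed: for `d = 0` the
  -- constant `true` has distance 1 from linear.
  far⇒≤¾ : ∀ {d} ε .{{_ : Positive ε}} {f : BoolFun (suc d)} → Far ε (Linear (suc d)) f → ε ≤ + 3 / 4
  far⇒≤¾ {d} ε@(mkℚ +[1+ p ] q-1 _) {f} far = *≤* (subst₂ ℤ._≤_ (ℤ.pos-* (suc p) 4) (ℤ.pos-* 3 q) (+≤+ 4p≤3q))
    where
    open ℕ.≤-Reasoning
    q = suc q-1
    D = 2 ℕ.^ d
    c₀ = disagreements f (false ∷ zeros)
    c₁ = disagreements f (true ∷ zeros)
    expand : ∀ D p → D ℕ.* (p ℕ.* 4) ≡ p ℕ.* (2 ℕ.* D) ℕ.+ p ℕ.* (2 ℕ.* D)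
    expand = solve-∀
    rotate : ∀ D q → 3 ℕ.* D ℕ.* q ≡ D ℕ.* (3 ℕ.* q)
    rotate = solve-∀
    4p≤3q : suc p ℕ.* 4 ℕ.≤ 3 ℕ.* q
    4p≤3q = ℕ.*-cancelˡ-≤ D {{ℕ.m^n≢0 2 d}} (begin
      D ℕ.* (suc p ℕ.* 4)                                    ≡⟨ expand D (suc p) ⟩
      suc p ℕ.* 2 ℕ.^ suc d ℕ.+ suc p ℕ.* 2 ℕ.^ suc d        ≤⟨ ℕ.+-mono-≤ (far-parity ε far (false ∷ zeros)) (far-parity ε far (true ∷ zeros)) ⟩
      c₀ ℕ.* q ℕ.+ c₁ ℕ.* q                                  ≡⟨ ℕ.*-distribʳ-+ q c₀ c₁ ⟨
      (c₀ ℕ.+ c₁) ℕ.* q                                      ≤⟨ ℕ.*-monoˡ-≤ q (two-parities f zeros) ⟩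
      3 ℕ.* D ℕ.* q                                          ≡⟨ rotate D q ⟩
      D ℕ.* (3 ℕ.* q)                                        ∎)

  -- Here `a` is `1 / c`. Multiplying the budget by `a ^ 4` and by the fifth power of
  -- `suc (scale ε)` clears both `c` and `ε`, since `ε * suc (scale ε)` is at most 2.
  erasure-budget-ℕ : ∀ d t ε .{{_ : Positive ε}} → ε ≤ 1ℚ → ∀ a c → fromℕ a * c ≡ 1ℚ → ErasureBudget c d t ε →
                     a ℕ.^ 4 ℕ.* (t ℕ.^ 4 ℕ.* suc (scale ε) ℕ.^ 5) ℕ.≤ 2 ℕ.^ 5 ℕ.* 2 ℕ.^ d
  erasure-budget-ℕ d t ε ε≤1 a c a*c≡1 budget = fromℕ-cancel-≤ {a ℕ.^ 4 ℕ.* (t ℕ.^ 4 ℕ.* n ℕ.^ 5)} {2 ℕ.^ 5 ℕ.* 2 ℕ.^ d} (begin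
    fromℕ (a ℕ.^ 4 ℕ.* (t ℕ.^ 4 ℕ.* n ℕ.^ 5))
      ≡⟨ trans (fromℕ-* (a ℕ.^ 4) (t ℕ.^ 4 ℕ.* n ℕ.^ 5)) (cong₂ _*_ (fromℕ-^ a 4) (trans (fromℕ-* (t ℕ.^ 4) (n ℕ.^ 5)) (cong₂ _*_ (fromℕ-^ t 4) (fromℕ-^ n 5)))) ⟩
    A ^ 4 * (fromℕ t ^ 4 * ν ^ 5)
      ≤⟨ ℚ.*-monoˡ-≤-nonNeg (A ^ 4) {{^-nonNeg A {{fromℕ-nonNeg a}} 4}} (ℚ.*-monoʳ-≤-nonNeg (ν ^ 5) {{^-nonNeg ν {{fromℕ-nonNeg n}} 5}} budget) ⟩
    A ^ 4 * ((c ^ 4 * ε ^ 5 * P) * ν ^ 5)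
      ≡⟨ shuffle (A ^ 4) (c ^ 4) (ε ^ 5) P (ν ^ 5) ⟩
    (A ^ 4 * c ^ 4) * ((ε ^ 5 * ν ^ 5) * P)
      ≡⟨ cong₂ (λ u v → u * (v * P)) (^-distrib-* A c 4) (^-distrib-* ε ν 5) ⟨
    (A * c) ^ 4 * ((ε * ν) ^ 5 * P)
      ≡⟨ trans (cong (λ u → u ^ 4 * ((ε * ν) ^ 5 * P)) a*c≡1) (ℚ.*-identityˡ ((ε * ν) ^ 5 * P)) ⟩
    (ε * ν) ^ 5 * P
      ≤⟨ ℚ.*-monoʳ-≤-nonNeg P {{^-nonNeg (fromℕ 2) {{fromℕ-nonNeg 2}} d}} (^-monoˡ-≤-nonNeg 5 {{εν-nonNeg}} {{fromℕ-nonNeg 2}} (ε·n≤2 ε ε≤1)) ⟩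
    fromℕ 2 ^ 5 * P
      ≡⟨ trans (fromℕ-* (2 ℕ.^ 5) (2 ℕ.^ d)) (cong₂ _*_ (fromℕ-^ 2 5) (fromℕ-^ 2 d)) ⟨
    fromℕ (2 ℕ.^ 5 ℕ.* 2 ℕ.^ d) ∎)
    where
    open ℚ.≤-Reasoning
    n = suc (scale ε)
    ν = fromℕ n
    A = fromℕ a
    P = fromℕ 2 ^ d
    εν-nonNeg : NonNegative (ε * ν)
    εν-nonNeg = ℚ.nonNeg*nonNeg⇒nonNeg ε {{ℚ.pos⇒nonNeg ε}} ν {{fromℕ-nonNeg n}}
    shuffle : ∀ a c e p n → a * ((c * e * p) * n) ≡ (a * c) * ((e * n) * p)
    shuffle = solve 5 (λ a c e p n → a :* ((c :* e :* p) :* n) := (a :* c) :* ((e :* n) :* p)) refl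
      where open +-*-Solver

  -- The last hypothesis says that `L` is at most `e` times the logarithm of `x`, and `y` is at most
  -- `c * L`. Raising it to the power `c * q`, with `q` the denominator of `y`, avoids logarithms.
  ·log₂-intro : ∀ y .{{_ : NonNegative y}} x .{{_ : NonNegative x}} L c e {C} → C ≡ e ℕ.* c →
                y ≤ fromℕ (c ℕ.* L) → fromℕ (2 ℕ.^ L) ≤ x ^ e → y ≤ C ·log₂ x
  ·log₂-intro y@(mkℚ (+ m) q-1 _) x L c e refl y≤cL 2^L≤x^e = begin
    fromℕ 2 ^ m                        ≡⟨ fromℕ-^ 2 m ⟨
    fromℕ (2 ℕ.^ m)                    ≤⟨ fromℕ-mono-≤ (ℕ.^-monoʳ-≤ 2 m≤) ⟩
    fromℕ (2 ℕ.^ (L ℕ.* (c ℕ.* q)))    ≡⟨ cong fromℕ (ℕ.^-*-assoc 2 L (c ℕ.* q)) ⟨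
    fromℕ ((2 ℕ.^ L) ℕ.^ (c ℕ.* q))    ≡⟨ fromℕ-^ (2 ℕ.^ L) (c ℕ.* q) ⟩
    fromℕ (2 ℕ.^ L) ^ (c ℕ.* q)        ≤⟨ ^-monoˡ-≤-nonNeg (c ℕ.* q) {{fromℕ-nonNeg (2 ℕ.^ L)}} {{^-nonNeg x e}} 2^L≤x^e ⟩
    (x ^ e) ^ (c ℕ.* q)                ≡⟨ ^-assocʳ x e (c ℕ.* q) ⟩
    x ^ (e ℕ.* (c ℕ.* q))              ≡⟨ cong (x ^_) (ℕ.*-assoc e c q) ⟨
    x ^ (e ℕ.* c ℕ.* q)                ∎
    where
    open ℚ.≤-Reasoning
    q = suc q-1
    rotate : ∀ c L q → c ℕ.* L ℕ.* q ≡ L ℕ.* (c ℕ.* q)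
    rotate = solve-∀
    m≤ : m ℕ.≤ L ℕ.* (c ℕ.* q)
    m≤ = subst (m ℕ.≤_) (rotate c L q) (ℤ.drop‿+≤+
      (subst₂ ℤ._≤_ (ℤ.*-identityʳ (+ m)) (sym (ℤ.pos-* (c ℕ.* L) q)) (≤-/⁻¹ y (c ℕ.* L) 1 y≤cL)))

  ÷-* : ∀ p ε .{{_ : NonZero ε}} → (p ÷ ε) * ε ≡ p
  ÷-* p ε = trans (ℚ.*-assoc p (1/ ε) ε) (trans (cong (p *_) (ℚ.*-inverseˡ ε)) (ℚ.*-identityʳ p))

  ≤-÷ : ∀ ε .{{_ : Positive ε}} .{{ε≢0 : NonZero ε}} {p r} → r * ε ≤ p → r ≤ p ÷ ε
  ≤-÷ ε {p} {r} le = ℚ.*-cancelʳ-≤-pos ε (subst (r * ε ≤_) (sym (÷-* p ε)) le)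

  ⁴⁄₃≤⇒2≤^3 : ∀ x → + 4 / 3 ≤ x → fromℕ 2 ≤ x ^ 3
  ⁴⁄₃≤⇒2≤^3 x le = ℚ.≤-trans (toWitness {a? = fromℕ 2 ℚ.≤? (+ 4 / 3) ^ 3} tt)
    (^-monoˡ-≤-nonNeg 3 {{_}} {{ℚ.nonNegative (ℚ.≤-trans (toWitness {a? = 0ℚ ℚ.≤? + 4 / 3} tt) le)}} le)

  -- `2 ^ depth` is at most `256 * t * n`, hence at most `2 ^ 9 * x`. As `x` is bounded away from 1,
  -- the constant is absorbed by a power: 2 is at most `x ^ 3` because `(4/3) ^ 3 = 64/27`, and
  -- `28 = 1 + 3 * 9`.
  depth-log : ∀ t ε .{{_ : Positive ε}} .{{ε≢0 : NonZero ε}} → ε ≤ 1ℚ → let x = fromℕ (suc t) ÷ ε in + 4 / 3 ≤ x →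
              fromℕ (2 ℕ.^ depth (suc t) (scale ε)) ≤ x ^ 28
  depth-log t ε ε≤1 x≥ = begin
    fromℕ (2 ℕ.^ depth (suc t) (scale ε))           ≤⟨ fromℕ-mono-≤ (depth-upper t (scale ε)) ⟩
    fromℕ (256 ℕ.* (suc t ℕ.* n))                   ≡⟨ trans (fromℕ-* 256 (suc t ℕ.* n)) (cong (fromℕ 256 *_) (fromℕ-* (suc t) n)) ⟩
    fromℕ 256 * (fromℕ (suc t) * fromℕ n)           ≡⟨ cong (λ p → fromℕ 256 * (p * fromℕ n)) (÷-* (fromℕ (suc t)) ε) ⟨
    fromℕ 256 * (x * ε * fromℕ n)                   ≡⟨ cong (fromℕ 256 *_) (ℚ.*-assoc x ε (fromℕ n)) ⟩
    fromℕ 256 * (x * (ε * fromℕ n))                 ≤⟨ ℚ.*-monoˡ-≤-nonNeg (fromℕ 256) (ℚ.*-monoˡ-≤-nonNeg x {{x≥0}} (ε·n≤2 ε ε≤1)) ⟩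
    fromℕ 256 * (x * fromℕ 2)                       ≡⟨ rotate (fromℕ 256) x (fromℕ 2) ⟩
    x * (fromℕ 256 * fromℕ 2)                       ≡⟨ cong (x *_) (trans (sym (fromℕ-* 256 2)) (fromℕ-^ 2 9)) ⟩
    x * fromℕ 2 ^ 9                                 ≤⟨ ℚ.*-monoˡ-≤-nonNeg x {{x≥0}} (^-monoˡ-≤-nonNeg 9 {{fromℕ-nonNeg 2}} {{^-nonNeg x {{x≥0}} 3}} (⁴⁄₃≤⇒2≤^3 x x≥)) ⟩
    x * (x ^ 3) ^ 9                                 ≡⟨ cong (x *_) (^-assocʳ x 3 9) ⟩
    x ^ 28                                          ∎
    where
    open ℚ.≤-Reasoning
    n = suc (scale ε)
    x = fromℕ (suc t) ÷ ε
    x≥0 : NonNegative x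
    x≥0 = ℚ.nonNegative (ℚ.≤-trans (toWitness {a? = 0ℚ ℚ.≤? + 4 / 3} tt) x≥)
    rotate : ∀ a b c → a * (b * c) ≡ b * (a * c)
    rotate = solve 3 (λ a b c → a :* (b :* c) := b :* (a :* c)) refl
      where open +-*-Solver

  -- The constant 180 is the product of 10 from `iterations`, 2 from `ε·n≤2` and 9 from
  -- `query-count`.
  queries-bound : ∀ t ε .{{_ : Positive ε}} → ε ≤ 1ℚ → let n = scale ε in
    fromℕ (iterations n ℕ.* suc (2 ℕ.* width (suc t) n)) * ε ≤ fromℕ (180 ℕ.* depth (suc t) n)
  queries-bound t ε ε≤1 = begin
    fromℕ (10 ℕ.* suc n ℕ.* Q) * ε              ≡⟨ cong (λ m → fromℕ m * ε) (regroup (suc n) Q) ⟩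
    fromℕ (10 ℕ.* Q ℕ.* suc n) * ε              ≡⟨ cong (_* ε) (fromℕ-* (10 ℕ.* Q) (suc n)) ⟩
    fromℕ (10 ℕ.* Q) * fromℕ (suc n) * ε        ≡⟨ trans (ℚ.*-assoc (fromℕ (10 ℕ.* Q)) (fromℕ (suc n)) ε) (cong (fromℕ (10 ℕ.* Q) *_) (ℚ.*-comm (fromℕ (suc n)) ε)) ⟩
    fromℕ (10 ℕ.* Q) * (ε * fromℕ (suc n))      ≤⟨ ℚ.*-monoˡ-≤-nonNeg (fromℕ (10 ℕ.* Q)) {{fromℕ-nonNeg (10 ℕ.* Q)}} (ε·n≤2 ε ε≤1) ⟩
    fromℕ (10 ℕ.* Q) * fromℕ 2                  ≡⟨ fromℕ-* (10 ℕ.* Q) 2 ⟨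
    fromℕ (10 ℕ.* Q ℕ.* 2)                      ≤⟨ fromℕ-mono-≤ count ⟩
    fromℕ (180 ℕ.* L)                           ∎
    where
    open ℚ.≤-Reasoning
    n = scale ε
    L = depth (suc t) n
    Q = suc (2 ℕ.* width (suc t) n)
    regroup : ∀ n Q → 10 ℕ.* n ℕ.* Q ≡ 10 ℕ.* Q ℕ.* n
    regroup = solve-∀
    twenty : ∀ Q → 10 ℕ.* Q ℕ.* 2 ≡ 20 ℕ.* Q
    twenty = solve-∀
    count : 10 ℕ.* Q ℕ.* 2 ℕ.≤ 180 ℕ.* L
    count = subst₂ ℕ._≤_ (sym (twenty Q)) (sym (ℕ.*-assoc 20 9 L)) (ℕ.*-monoʳ-≤ 20 (query-count t n))

-- The tester with its parameters, and its correctness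

module _ where
  open import Data.Integer.Base using (+_)
  open import Data.Rational.Base using (_*_; _≤_)
  open ∑ℕ using (∑)

  sampling : ∀ d k N → RandomizedAlgorithm d
  sampling d k N = uniform (vectors (seeds d k) N) (λ ω → verify ω true)

  always-accept : ∀ d → RandomizedAlgorithm d
  always-accept d = record { coins-1 = 0 ; branch = λ _ → output true }

  -- For t ≥ 1 and ε close to 1 the query budget tends to 0, but then no function is ε-far from linear.
  -- At t = 0 the tester uses t = 2, as logBudget does; it is written suc 1 so that the instances of width agree syntactically.
  dispatch : ∀ {d} {A : Set} → (ℕ → RandomizedAlgorithm d) → Dec A → ℕ → RandomizedAlgorithm d
  dispatch     T dec     zero    = T (suc 1)
  dispatch     T (yes _) (suc t) = T (suc t)
  dispatch {d} T (no _)  (suc t) = always-accept d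

  dispatch-elim : ∀ {d} {A : Set} (P : ℕ → RandomizedAlgorithm d → Set) T (dec : Dec A) → P 0 (T (suc 1)) →
                  (∀ t → A → P (suc t) (T (suc t))) → (∀ t → ¬ A → P (suc t) (always-accept d)) →
                  ∀ t → P t (dispatch T dec t)
  dispatch-elim P T dec     p-zero p-yes p-no zero    = p-zero
  dispatch-elim P T (yes a) p-zero p-yes p-no (suc t) = p-yes t a
  dispatch-elim P T (no ¬a) p-zero p-yes p-no (suc t) = p-no t ¬a

  tester : ∀ d → ℕ → ℚ → RandomizedAlgorithm d
  tester d t ε = dispatch (λ t′ → sampling d (width t′ (scale ε)) (iterations (scale ε))) (ε ℚ.≤? + 3 / 4) t

  -- `4096 ^ 4 = 2 ^ 48`: a factor `2 ^ 5` pays for `ε * n ≤ 2` in the fifth power, and `2 ^ 43` is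
  -- left for the parameter bounds.
  c₀ : ℚ
  c₀ = + 1 / 4096

  C₀ : ℕ
  C₀ = 28 ℕ.* 180

  Correct : ∀ d → ℕ → (ε : ℚ) → .{{_ : Positive ε}} → RandomizedAlgorithm d → Set
  Correct d t ε T =
    OneSided t (Linear d) T ×
    Nonadaptive T ×
    (ErasureBudget c₀ d t ε → IsResilientTester t ε (Linear d) T) ×
    (∃[ q ] (MakesAtMost q T × WithinQueryBudget C₀ q t ε {{pos⇒nonZero ε}}))

  budget⇒large : ∀ d t ε .{{_ : Positive ε}} → ε ≤ 1ℚ → ErasureBudget c₀ d t ε →
                 2 ℕ.^ 43 ℕ.* (t ℕ.^ 4 ℕ.* suc (scale ε) ℕ.^ 5) ℕ.≤ 2 ℕ.^ d
  budget⇒large d t ε ε≤1 budget = ℕ.*-cancelˡ-≤ 32 (subst (ℕ._≤ 32 ℕ.* 2 ℕ.^ d) split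
    (erasure-budget-ℕ d t ε ε≤1 4096 c₀ refl budget))
    where
    Y = t ℕ.^ 4 ℕ.* suc (scale ε) ℕ.^ 5
    split : 4096 ℕ.^ 4 ℕ.* Y ≡ 32 ℕ.* (2 ℕ.^ 43 ℕ.* Y)
    split = trans (cong (ℕ._* Y) {4096 ℕ.^ 4} {32 ℕ.* 2 ℕ.^ 43} refl) (ℕ.*-assoc 32 (2 ℕ.^ 43) Y)

  length-vectors : ∀ {A : Set} (xs : List A) k → length (vectors xs k) ≡ length xs ℕ.^ k
  length-vectors xs k = trans (sym (∑-1 (vectors xs k))) (trans (∑-vectors-const xs k 1) (ℕ.*-identityʳ _))

  seeds-nonempty : ∀ d k → ℕ.NonZero (length (seeds d k))
  seeds-nonempty d k = subst ℕ.NonZero (sym (length-seeds d k))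
    (ℕ.m*n≢0 ((2 ℕ.^ d ℕ.* 2 ℕ.^ d) ℕ.^ k) (2 ℕ.^ k)
      {{ℕ.m^n≢0 (2 ℕ.^ d ℕ.* 2 ℕ.^ d) k {{ℕ.m*n≢0 (2 ℕ.^ d) (2 ℕ.^ d) {{ℕ.m^n≢0 2 d}} {{ℕ.m^n≢0 2 d}}}}}}
      {{ℕ.m^n≢0 2 k}})

  one-sided⇒accepts : ∀ {d t} {P : Property d} T → OneSided t P T → ∀ f (σ : Strategy t d) → P f → + 2 / 3 ≤ Pr[accept] T f σ
  one-sided⇒accepts T one-sided f σ p = subst (+ 2 / 3 ≤_) (sym (one-sided f σ p)) (toWitness {a? = + 2 / 3 ℚ.≤? 1ℚ} tt)

  sampling-one-sided : ∀ d t k N → OneSided t (Linear d) (sampling d k N)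
  sampling-one-sided d t k N f σ linear = Pr-certain _
    (uniform-all {P = λ alg → accepts f σ alg ≡ true} (vectors (seeds d k) N) refl
      (λ ω → execute-accepting σ (verify ω true) [] _ (verify-accepting linear ω) (λ x → inj₁ refl)))

  sampling-nonadaptive : ∀ d k N → Nonadaptive (sampling d k N)
  sampling-nonadaptive d k N = uniform-all {P = λ alg → ∃[ xs ] Asks alg xs} (vectors (seeds d k) N)
    ([] , output) (λ ω → questions ω , verify-asks ω true)

  sampling-queries : ∀ d k N → MakesAtMost (N ℕ.* suc (2 ℕ.* k)) (sampling d k N)
  sampling-queries d k N = uniform-all {P = QueryBound (N ℕ.* suc (2 ℕ.* k))} (vectors (seeds d k) N) output
    (λ ω → subst (λ q → QueryBound q (verify ω true)) (length-questions ω) (asks⇒queryBound (verify-asks ω true)))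

  sampling-rejects : ∀ d t k N f (σ : Strategy t d) →
    3 ℕ.* ∑ (vectors (seeds d k) N) (λ ω → ⟦ accepts f σ (verify ω true) ⟧) ℕ.≤ length (seeds d k) ℕ.^ N →
    + 2 / 3 ≤ Pr[reject] (sampling d k N) f σ
  sampling-rejects d t k N f σ few = Pr-uniform-≥⅔ (vectors (seeds d k) N) (λ ω → verify ω true) (accepts f σ)
    (subst (0 ℕ.<_) (sym (length-vectors (seeds d k) N)) (ℕ.m^n>0 (length (seeds d k)) {{seeds-nonempty d k}} N))
    (subst (3 ℕ.* ∑ (vectors (seeds d k) N) (λ ω → ⟦ accepts f σ (verify ω true) ⟧) ℕ.≤_) (sym (length-vectors (seeds d k) N)) few)

  -- The tester is built for `suc t′` erasures and faces `t`; the two differ only at `t = 0`. The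
  -- bound on expected hits is a hypothesis because its proof is what separates `t = 0` from
  -- `t ≥ 1`.
  sampling-correct : ∀ d t t′ ε .{{_ : Positive ε}} → ε ≤ 1ℚ → logBudget t ≡ suc t′ →
    + 4 / 3 ≤ (fromℕ (suc t′) ÷ ε) {{pos⇒nonZero ε}} → let k = width (suc t′) (scale ε); N = iterations (scale ε) in
    (ErasureBudget c₀ d t ε → ∀ f (σ : Strategy t d) →
      6 ℕ.* ∑ (vectors (seeds d k) N) (λ ω → hits σ (initial f) (questions ω)) ℕ.≤ length (seeds d k) ℕ.^ N) →
    Correct d t ε (sampling d k N)
  sampling-correct d t t′ ε ε≤1 t′≡ x≥ few =
      sampling-one-sided d t (width (suc t′) (scale ε)) (iterations (scale ε))
    , sampling-nonadaptive d (width (suc t′) (scale ε)) (iterations (scale ε))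
    , (λ budget f σ →
          one-sided⇒accepts {P = Linear d} (sampling d (width (suc t′) (scale ε)) (iterations (scale ε))) (sampling-one-sided d t (width (suc t′) (scale ε)) (iterations (scale ε))) f σ
        , λ far → sampling-rejects d t (width (suc t′) (scale ε)) (iterations (scale ε)) f σ
            (soundness f σ (scale ε) {width (suc t′) (scale ε)} (ℕ.pred (2 ℕ.* depth (suc t′) (scale ε))) refl (far-scaled ε far) (few budget f σ)))
    , iterations (scale ε) ℕ.* suc (2 ℕ.* width (suc t′) (scale ε))
    , sampling-queries d (width (suc t′) (scale ε)) (iterations (scale ε))
    , within (iterations (scale ε) ℕ.* suc (2 ℕ.* width (suc t′) (scale ε))) (queries-bound t′ ε ε≤1)
    where
    x = (fromℕ (suc t′) ÷ ε) {{pos⇒nonZero ε}}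
    x≥0 : NonNegative x
    x≥0 = ℚ.nonNegative (ℚ.≤-trans (toWitness {a? = 0ℚ ℚ.≤? + 4 / 3} tt) x≥)
    within : ∀ q → fromℕ q * ε ≤ fromℕ (180 ℕ.* depth (suc t′) (scale ε)) → WithinQueryBudget C₀ q t ε {{pos⇒nonZero ε}}
    within q qε≤ = subst (λ l → (fromℕ q * ε) ≤ C₀ ·log₂ ((fromℕ l ÷ ε) {{pos⇒nonZero ε}})) (sym t′≡)
      (·log₂-intro (fromℕ q * ε) {{ℚ.nonNeg*nonNeg⇒nonNeg (fromℕ q) {{fromℕ-nonNeg q}} ε {{ℚ.pos⇒nonNeg ε}}}} x {{x≥0}}
        (depth (suc t′) (scale ε)) 180 28 {C₀} refl qε≤ (depth-log t′ ε {{ε≢0 = pos⇒nonZero ε}} ε≤1 x≥))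

  product≰1 : ∀ a b → 2 ℕ.≤ a → .{{_ : ℕ.NonZero b}} → ¬ a ℕ.* b ℕ.≤ 1
  product≰1 a b 2≤a a*b≤1 = ℕ.<⇒≱ 2≤a (ℕ.≤-trans (ℕ.m≤m*n a b) a*b≤1)

  few-hits-within-budget : ∀ d t₀ n f (σ : Strategy (suc t₀) d) →
    2 ℕ.^ 43 ℕ.* (suc t₀ ℕ.^ 4 ℕ.* suc n ℕ.^ 5) ℕ.≤ 2 ℕ.^ d → let k = width (suc t₀) n; N = iterations n in
    6 ℕ.* ∑ (vectors (seeds d k) N) (λ ω → hits σ (initial f) (questions ω)) ℕ.≤ length (seeds d k) ℕ.^ N
  few-hits-within-budget d t₀ n f σ large = few-hits f σ (width (suc t₀) n) n
    (first-bound t₀ n large) (final-bound t₀ n) (collision-budget t₀ n large)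

  -- The threshold 3/4 on `ε` keeps `t / ε` at least 4/3, so the logarithm in the query budget stays
  -- away from 0.
  ratio-≤¾ : ∀ t₀ ε .{{_ : Positive ε}} → ε ≤ + 3 / 4 → + 4 / 3 ≤ (fromℕ (suc t₀) ÷ ε) {{pos⇒nonZero ε}}
  ratio-≤¾ t₀ ε ε≤¾ = ≤-÷ ε {{ε≢0 = pos⇒nonZero ε}} {fromℕ (suc t₀)} {+ 4 / 3}
    (ℚ.≤-trans (ℚ.*-monoˡ-≤-nonNeg (+ 4 / 3) ε≤¾) (fromℕ-mono-≤ {1} {suc t₀} (s≤s z≤n)))

  ratio-≥1 : ∀ t₀ ε .{{_ : Positive ε}} → ε ≤ 1ℚ → 1ℚ ≤ (fromℕ (suc t₀) ÷ ε) {{pos⇒nonZero ε}}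
  ratio-≥1 t₀ ε ε≤1 = ≤-÷ ε {{ε≢0 = pos⇒nonZero ε}} {fromℕ (suc t₀)} {1ℚ}
    (ℚ.≤-trans (ℚ.≤-reflexive (ℚ.*-identityˡ ε)) (ℚ.≤-trans ε≤1 (fromℕ-mono-≤ {1} {suc t₀} (s≤s z≤n))))

  always-accept-correct : ∀ d t₀ ε .{{_ : Positive ε}} → ε ≤ 1ℚ → ¬ ε ≤ + 3 / 4 → Correct d (suc t₀) ε (always-accept d)
  always-accept-correct d t₀ ε ε≤1 ε≰¾ =
      one-sided
    , (λ _ → [] , output)
    , (λ budget f σ →
          one-sided⇒accepts {P = Linear d} (always-accept d) one-sided f σ
        , λ far → ⊥-elim (not-far d (budget⇒large d (suc t₀) ε ε≤1 budget) far))
    , 0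
    , (λ _ → output)
    , ·log₂-intro (fromℕ 0 * ε) {{ℚ.nonNeg*nonNeg⇒nonNeg (fromℕ 0) ε {{ℚ.pos⇒nonNeg ε}}}} x {{x≥0}} 0 180 28 {C₀} refl
        (ℚ.≤-reflexive (ℚ.*-zeroˡ ε)) (1≤^ x 28 (ratio-≥1 t₀ ε ε≤1))
    where
    one-sided : OneSided (suc t₀) (Linear d) (always-accept d)
    one-sided f σ linear = refl
    x = (fromℕ (suc t₀) ÷ ε) {{pos⇒nonZero ε}}
    x≥0 : NonNegative x
    x≥0 = ℚ.nonNegative (ℚ.≤-trans (toWitness {a? = 0ℚ ℚ.≤? 1ℚ} tt) (ratio-≥1 t₀ ε ε≤1))
    not-far : ∀ d → 2 ℕ.^ 43 ℕ.* (suc t₀ ℕ.^ 4 ℕ.* suc (scale ε) ℕ.^ 5) ℕ.≤ 2 ℕ.^ d → {f : BoolFun d} → ¬ Far ε (Linear d) f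
    not-far (suc d) _     far = ε≰¾ (far⇒≤¾ ε far)
    -- For `d = 0` a function can be far from linear, but then the budget would bound a number of at
    -- least `2 ^ 43` by `2 ^ 0`.
    not-far zero    large far = product≰1 (2 ℕ.^ 43) (suc t₀ ℕ.^ 4 ℕ.* suc (scale ε) ℕ.^ 5) (ℕ.≤ᵇ⇒≤ 2 (2 ℕ.^ 43) tt)
      {{ℕ.m*n≢0 (suc t₀ ℕ.^ 4) (suc (scale ε) ℕ.^ 5) {{ℕ.m^n≢0 (suc t₀) 4}} {{ℕ.m^n≢0 (suc (scale ε)) 5}}}} large

  no-hits-without-erasures : ∀ d k N f (σ : Strategy 0 d) →
    6 ℕ.* ∑ (vectors (seeds d k) N) (λ ω → hits σ (initial f) (questions ω)) ℕ.≤ length (seeds d k) ℕ.^ N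
  no-hits-without-erasures d k N f σ = subst (λ h → 6 ℕ.* h ℕ.≤ length (seeds d k) ℕ.^ N)
    (sym (trans (∑ℕ.∑-cong (vectors (seeds d k) N) (λ ω → no-hits σ (initial f) (questions ω) (ℕ.≤-reflexive (erased-initial f))))
      (∑ℕ.∑-zero (vectors (seeds d k) N)))) z≤n

  ratio-2 : ∀ ε .{{_ : Positive ε}} → ε ≤ 1ℚ → + 4 / 3 ≤ (fromℕ (suc 1) ÷ ε) {{pos⇒nonZero ε}}
  ratio-2 ε ε≤1 = ≤-÷ ε {{ε≢0 = pos⇒nonZero ε}} {fromℕ (suc 1)} {+ 4 / 3}
    (ℚ.≤-trans (ℚ.*-monoˡ-≤-nonNeg (+ 4 / 3) ε≤1) (toWitness {a? = + 4 / 3 * 1ℚ ℚ.≤? fromℕ 2} tt))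

  tester-correct : ∀ d t ε .{{_ : Positive ε}} → ε ≤ 1ℚ → Correct d t ε (tester d t ε)
  tester-correct d t ε ε≤1 = dispatch-elim (λ t → Correct d t ε)
    (λ t′ → sampling d (width t′ (scale ε)) (iterations (scale ε))) (ε ℚ.≤? + 3 / 4)
    (sampling-correct d 0 1 ε ε≤1 refl (ratio-2 ε ε≤1)
      (λ budget → no-hits-without-erasures d (width (suc 1) (scale ε)) (iterations (scale ε))))
    (λ t₀ ε≤¾ → sampling-correct d (suc t₀) t₀ ε ε≤1 refl (ratio-≤¾ t₀ ε ε≤¾)
      (λ budget f σ → few-hits-within-budget d t₀ (scale ε) f σ (budget⇒large d (suc t₀) ε ε≤1 budget)))
    (λ t₀ → always-accept-correct d t₀ ε ε≤1)
    t

open import Data.Rational.Base using (_<_; _≤_)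

theorem2p1 : Σ[ c₀ ∈ ℚ ] Σ[ C ∈ ℕ ] Σ[ tester ∈ ((d t : ℕ) (ε : ℚ) → RandomizedAlgorithm d) ]
    (0ℚ < c₀ × c₀ < 1ℚ ×
    (∀ (d t : ℕ) (ε : ℚ) .{{_ : Positive ε}} → ε ≤ 1ℚ →
    OneSided t (Linear d) (tester d t ε) ×
    Nonadaptive (tester d t ε) ×
    (ErasureBudget c₀ d t ε → IsResilientTester t ε (Linear d) (tester d t ε)) ×
    (∃[ q ] (MakesAtMost q (tester d t ε) × WithinQueryBudget C q t ε {{pos⇒nonZero ε}}))))
theorem2p1 = c₀ , C₀ , tester , toWitness {a? = 0ℚ ℚ.<? c₀} tt , toWitness {a? = c₀ ℚ.<? 1ℚ} tt , tester-correct
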